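{- Let $\{A_0=I_{n-1}, A_1, A_2={}^tA_1\}$ be a non-symmetric association scheme of rank $3$ and order $n-1$, and let $\sigma_h$ ($h\in H$) and $\mu_g$ ($g\in G\setminus H$) be the $4n\times 4n$ matrices constructed from it in the context. Then the set $\mathcal{D}=\{\sigma_h\mid h\in H\}\cup\{\mu_g\mid g\in G\setminus H\}$ forms an association scheme.
   Context: ${}^tM$ is the transpose of $M$, $I_N$ the $N\times N$ identity matrix, $J_N$ the $N\times N$ all-ones matrix, $\otimes$ the Kronecker product. Association scheme: a set $\mathcal{S}=\{S_0,\dots,S_d\}$ of $d+1$ non-zero $N\times N$ matrices with entries in $\{0,1\}$ is an association scheme of order $N$ and rank $d+1$ if (1) $S_0=I_N$; (2) $\sum_{i=0}^d S_i=J_N$; (3) for all $0\le i,j\le d$, ${}^tS_i$ and $S_iS_j$ are linear combinations of $S_0,\dots,S_d$. It is symmetric if ${}^tS_i=S_i$ for all $i$, and non-symmetric otherwise. Group: let $x,y$ be the permutation matrices $$x=\begin{pmatrix}0&1&0&0\\0&0&1&0\\0&0&0&1\\1&0&0&0\end{pmatrix},\quad y=\begin{pmatrix}0&1&0&0\\1&0&0&0\\0&0&0&1\\0&0&1&0\end{pmatrix}$$ and $G=\langle x,y\rangle\cong D_8$ the group of order $8$ generated by them under matrix multiplication; its identity is $1=I_4$. Let $H=C_G(y)=\{1,x^2,y,x^2y\}$, so $G\setminus H=\{x,x^3,xy,x^3y\}$. Construction of $\mathcal{D}$: given the scheme $\{A_0,A_1,A_2\}$ of order $n-1$ (it is known that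 then $n\equiv 0\pmod 4$), define $n\times n$ block matrices (blocks of sizes $1$ and $n-1$; $\mathbf{1}$ is the all-ones row vector of length $n-1$) $$E=\begin{pmatrix}0&\mathbf{1}\\ {}^t\mathbf{1}&O\end{pmatrix},\qquad \tilde{A}_i=\begin{pmatrix}0&0\\0&A_i\end{pmatrix}\ (i=1,2).$$ Define $4n\times 4n$ matrices $\sigma_h=I_n\otimes h$ for $h\in H$ and $\mu_g=E\otimes g+\tilde{A}_1\otimes gy+\tilde{A}_2\otimes gx^2y$ for $g\in G\setminus H$. -}

module Defs where

open import Algebra.Bundles using (CommutativeRing)
open import Data.Bool.Base using (if_then_else_)
open import Data.Fin.Base using (Fin; zero; suc; quotient; remainder)
open import Data.Fin.Properties using (_≟_)
open import Data.Nat.Base as ℕ using (ℕ; zero; suc)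
open import Data.Product.Base using (Σ-syntax; ∃-syntax; _×_)
open import Data.Rational.Base using (ℚ; 0ℚ; 1ℚ; _+_; _*_)
open import Data.Rational.Properties using (+-*-commutativeRing)
open import Data.Sum.Base using (_⊎_)
open import Data.Vec.Functional using (Vector; []; _∷_)
open import Function.Bundles using (_⇔_)
open import Level using (0ℓ)
open import Relation.Binary.PropositionalEquality using (_≡_)
open import Relation.Nullary using (¬_; does)
open import Relation.Unary using (Pred; _∈_; _∉_)

open import Algebra.Properties.Semiring.Sum
  (CommutativeRing.semiring +-*-commutativeRing) public using (sum)

-- The scalars are ℚ.  For disjoint non-zero 0/1 matrices, the coefficients of
-- a 0/1 or natural-number matrix in a linear combination are entries of that
-- matrix, so any field of characteristic 0 gives the same association schemes.
Matrix : ℕ → ℕ → Set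
Matrix m n = Vector (Vector ℚ n) m

-- Entrywise equality: matrices are functions, and function extensionality is
-- not available.
infix 4 _≈_
_≈_ : ∀ {m n} → Matrix m n → Matrix m n → Set
A ≈ B = ∀ i j → A i j ≡ B i j

I : ∀ n → Matrix n n
I n i j = if does (i ≟ j) then 1ℚ else 0ℚ

J : ∀ n → Matrix n n
J n i j = 1ℚ

O : ∀ m n → Matrix m n
O m n i j = 0ℚ

infix 9 ᵗ_
ᵗ_ : ∀ {m n} → Matrix m n → Matrix n m
(ᵗ A) i j = A j i

infixl 6 _⊕_
_⊕_ : ∀ {m n} → Matrix m n → Matrix m n → Matrix m n
(A ⊕ B) i j = A i j + B i j

infixl 7 _∙_
_∙_ : ∀ {l m n} → Matrix l m → Matrix m n → Matrix l n
(A ∙ B) i j = sum (λ k → A i k * B k j)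

-- Row index i of A ⊗ B encodes the pair (row of A, row of B) with the row of A
-- as the more significant digit; likewise for columns.
infixl 7 _⊗_
_⊗_ : ∀ {m n p q} → Matrix m n → Matrix p q → Matrix (m ℕ.* p) (n ℕ.* q)
_⊗_ {m} {n} {p} {q} A B i j =
  A (quotient p i) (quotient q j) * B (remainder {m} p i) (remainder {n} q j)

linearCombination : ∀ {r m n} → Vector ℚ r → Vector (Matrix m n) r → Matrix m n
linearCombination c S i j = sum (λ k → c k * S k i j)

IsLinearCombinationOf : ∀ {r m n} → Matrix m n → Vector (Matrix m n) r → Set
IsLinearCombinationOf {r} M S = Σ[ c ∈ Vector ℚ r ] M ≈ linearCombination c S

record IsAssociationScheme {d N : ℕ} (S : Vector (Matrix N N) (suc d)) : Set where
  field
    distinct  : ∀ {i j} → S i ≈ S j → i ≡ j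
    nonZero   : ∀ i → ¬ (S i ≈ O N N)
    zeroOne   : ∀ i a b → S i a b ≡ 0ℚ ⊎ S i a b ≡ 1ℚ
    identity  : S zero ≈ I N
    sum≈J     : ∀ a b → sum (λ i → S i a b) ≡ J N a b
    transpose : ∀ i → IsLinearCombinationOf (ᵗ (S i)) S
    product   : ∀ i j → IsLinearCombinationOf (S i ∙ S j) S

Symmetric : ∀ {r N} → Vector (Matrix N N) r → Set
Symmetric S = ∀ i → ᵗ (S i) ≈ S i

NonSymmetric : ∀ {r N} → Vector (Matrix N N) r → Set
NonSymmetric S = ¬ Symmetric S

-- A set of matrices, given as a predicate, forms an association scheme when
-- its elements can be listed as S₀, …, S_d satisfying the axioms.
FormsAssociationScheme : ∀ {N} → Pred (Matrix N N) 0ℓ → Set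
FormsAssociationScheme {N} 𝒮 =
  ∃[ d ] Σ[ S ∈ Vector (Matrix N N) (suc d) ]
    (∀ M → M ∈ 𝒮 ⇔ (∃[ i ] M ≈ S i)) × IsAssociationScheme S

x : Matrix 4 4
x = (0ℚ ∷ 1ℚ ∷ 0ℚ ∷ 0ℚ ∷ [])
  ∷ (0ℚ ∷ 0ℚ ∷ 1ℚ ∷ 0ℚ ∷ [])
  ∷ (0ℚ ∷ 0ℚ ∷ 0ℚ ∷ 1ℚ ∷ [])
  ∷ (1ℚ ∷ 0ℚ ∷ 0ℚ ∷ 0ℚ ∷ [])
  ∷ []

y : Matrix 4 4
y = (0ℚ ∷ 1ℚ ∷ 0ℚ ∷ 0ℚ ∷ [])
  ∷ (1ℚ ∷ 0ℚ ∷ 0ℚ ∷ 0ℚ ∷ [])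
  ∷ (0ℚ ∷ 0ℚ ∷ 0ℚ ∷ 1ℚ ∷ [])
  ∷ (0ℚ ∷ 0ℚ ∷ 1ℚ ∷ 0ℚ ∷ [])
  ∷ []

-- The group generated by x and y: ⁻¹-closed takes h to be a two-sided inverse
-- of g, and ≈-closed makes membership respect entrywise equality.
data G : Pred (Matrix 4 4) 0ℓ where
  x∈G       : x ∈ G
  y∈G       : y ∈ G
  1∈G       : I 4 ∈ G
  ∙-closed  : ∀ {g h} → g ∈ G → h ∈ G → g ∙ h ∈ G
  ⁻¹-closed : ∀ {g h} → g ∈ G → g ∙ h ≈ I 4 → h ∙ g ≈ I 4 → h ∈ G
  ≈-closed  : ∀ {g h} → g ∈ G → g ≈ h → h ∈ G

-- H = C_G(y).
H : Pred (Matrix 4 4) 0ℓ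
H h = h ∈ G × h ∙ y ≈ y ∙ h

G∖H : Pred (Matrix 4 4) 0ℓ
G∖H g = g ∈ G × g ∉ H

-- The given scheme has order m = n - 1, so n is suc m from here on.

E : ∀ m → Matrix (suc m) (suc m)
E m zero    zero    = 0ℚ
E m zero    (suc j) = 1ℚ
E m (suc i) zero    = 1ℚ
E m (suc i) (suc j) = 0ℚ

-- pad A₁ and pad A₂ are Ã₁ and Ã₂.
pad : ∀ {m} → Matrix m m → Matrix (suc m) (suc m)
pad A zero    zero    = 0ℚ
pad A zero    (suc j) = 0ℚ
pad A (suc i) zero    = 0ℚ
pad A (suc i) (suc j) = A i j

σ : ∀ m → Matrix 4 4 → Matrix (suc m ℕ.* 4) (suc m ℕ.* 4)
σ m h = I (suc m) ⊗ h

μ : ∀ {m} → (A₁ A₂ : Matrix m m) → Matrix 4 4 → Matrix (suc m ℕ.* 4) (suc m ℕ.* 4)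
μ {m} A₁ A₂ g = E m ⊗ g ⊕ pad A₁ ⊗ (g ∙ y) ⊕ pad A₂ ⊗ (g ∙ (x ∙ x ∙ y))

𝒟 : ∀ {m} → (A₁ A₂ : Matrix m m) → Pred (Matrix (suc m ℕ.* 4) (suc m ℕ.* 4)) 0ℓ
𝒟 {m} A₁ A₂ M =
    (∃[ h ] h ∈ H   × M ≈ σ m h)
  ⊎ (∃[ g ] g ∈ G∖H × M ≈ μ A₁ A₂ g)

{-# OPTIONS --safe #-}

-- A non-symmetric scheme of rank 3 is a doubly regular tournament: counting
-- gives a valency k with n = 2k + 2, A₁A₂ + A₂A₁ = 2kI + (k - 1)(A₁ + A₂) and
-- A₁² + A₂² = k(A₁ + A₂).  For g, g′ in the coset xH put t = gg′ ∈ H; moving y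
-- and x² past g′ turns μ_g μ_g′ into a sum of terms (block) ⊗ th with h ∈ H, and
-- these identities collect it to
--   (n - 1) I ⊗ t + k E ⊗ t(y + x²y) + k (Ã₁ + Ã₂) ⊗ t(1 + x²).
-- As x + x³ = y + x²y and xy + x³y = 1 + x² as matrices, this is
-- (n - 1) σ_t + k (μ_xt + μ_x³t).  The other products stay inside the set, and
-- the members sum to J because H and xH act regularly on the four points.
module Submission where

open import Defs
open import Algebra.Bundles using (CommutativeRing)
open import Data.Bool.Base using (if_then_else_)
open import Data.Fin.Base
  using (Fin; zero; suc; quotient; remainder; remQuot; combine; splitAt; join; _↑ˡ_; _↑ʳ_)
open import Data.Fin.Patterns using (0F; 1F; 2F; 3F)
open import Data.Fin.Properties
  using (_≟_; all?; ¬∀⟶∃¬; remQuot-combine; combine-remQuot; splitAt-join; join-splitAt)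
open import Data.Nat.Base as ℕ using (ℕ; zero; suc)
open import Data.Product.Base using (∃-syntax; ∃₂; _×_; _,_; proj₁; proj₂)
open import Data.Rational.Base using (ℚ; 0ℚ; 1ℚ; ½; _+_; _*_; _-_; _≤_; 1/_; ≢-nonZero)
open import Data.Rational.Properties as ℚ using (+-*-commutativeRing)
open import Data.Rational.Solver using (module +-*-Solver)
open import Data.Sum.Base using (_⊎_; inj₁; inj₂; [_,_]′)
open import Data.Vec.Functional using (Vector; []; _∷_)
open import Function.Base using (_∘_; _$_; id)
open import Function.Bundles using (_⇔_; mk⇔)
open import Relation.Binary.PropositionalEquality
  using (_≡_; _≢_; refl; sym; trans; cong; cong₂; subst; module ≡-Reasoning)
open import Relation.Nullary using (¬_; yes; no; contradiction)
open import Relation.Nullary.Decidable using (Dec; does; ¬?; from-yes; from-no; dec-true; dec-false)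
open import Relation.Unary using (_∈_; _∉_)

open import Algebra.Properties.Semiring.Sum (CommutativeRing.semiring +-*-commutativeRing)
  using (sum-cong-≗; sum-replicate-zero; ∑-distrib-+; ∑-comm; *-distribˡ-sum; *-distribʳ-sum)

open ≡-Reasoning
open +-*-Solver using (solve; _:+_; _:*_; _:-_; _:=_; con)

-- The relations x + x³ = y + x²y and xy + x³y = 1 + x² fail in the group algebra of D₈ and hold
-- only in its action on four points: x + x³ and y + x²y are both the adjacency matrix of a 4-cycle,
-- while xy + x³y and 1 + x² both mark the pairs at even distance in it. These relations bring sums
-- over H back to the coset xH. The twists y and x²y in μ_g are exchanged by conjugation with x. In
-- a product of two μ's this makes Ã₁Ã₂ and Ã₂Ã₁ meet E² at t, makes the two squares meet at tx²,
-- and pairs each product having E on the left with one having E on the right, which is how the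
-- block identities become applicable. On the group side everything is coded by `Fin 4`: the Klein
-- four-group H is `_⊻_`, the coset is reached through `rotate`, and facts about codes are settled
-- by evaluation over all cases.

private
  variable
    l m n p q r : ℕ

-- Finite sums

sum-zero : (f : Vector ℚ n) → (∀ i → f i ≡ 0ℚ) → sum f ≡ 0ℚ
sum-zero {n} f f≡0 = trans (sum-cong-≗ f≡0) (sum-replicate-zero n)

sum-++ : ∀ m (f : Vector ℚ (m ℕ.+ n)) → sum f ≡ sum (f ∘ (_↑ˡ n)) + sum (f ∘ (m ↑ʳ_))
sum-++ zero    f = sym (ℚ.+-identityˡ _)
sum-++ (suc m) f = trans (cong (f zero +_) (sum-++ m (f ∘ suc))) (sym (ℚ.+-assoc (f zero) _ _))

sum-combine : ∀ m (f : Vector ℚ (m ℕ.* n)) → sum f ≡ sum (λ i → sum (λ j → f (combine {m} i j)))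
sum-combine     zero    f = refl
sum-combine {n} (suc m) f = trans (sum-++ n f) (cong (sum (f ∘ (_↑ˡ m ℕ.* n)) +_) (sum-combine m (f ∘ (n ↑ʳ_))))

0≤sum : (f : Vector ℚ n) → (∀ i → 0ℚ ≤ f i) → 0ℚ ≤ sum f
0≤sum {zero}  f 0≤f = ℚ.≤-refl
0≤sum {suc n} f 0≤f = ℚ.+-mono-≤ (0≤f zero) (0≤sum (f ∘ suc) (0≤f ∘ suc))

-- Serves to bound the order and the valency of the scheme below by 1, so that both can be cancelled
-- in counting arguments.
term≤sum : (f : Vector ℚ n) → (∀ i → 0ℚ ≤ f i) → ∀ i → f i ≤ sum f
term≤sum f 0≤f zero    = subst (_≤ sum f) (ℚ.+-identityʳ (f zero)) (ℚ.+-monoʳ-≤ (f zero) (0≤sum (f ∘ suc) (0≤f ∘ suc)))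
term≤sum f 0≤f (suc i) = subst (_≤ sum f) (ℚ.+-identityˡ (f (suc i))) (ℚ.+-mono-≤ (0≤f zero) (term≤sum (f ∘ suc) (0≤f ∘ suc) i))

1≤⇒≢0 : ∀ {a} → 1ℚ ≤ a → a ≢ 0ℚ
1≤⇒≢0 1≤a refl = from-no (1ℚ ℚ.≤? 0ℚ) 1≤a

*-cancelˡ : ∀ {a b c} → a ≢ 0ℚ → a * b ≡ a * c → b ≡ c
*-cancelˡ {a} {b} {c} a≢0 ab≡ac = begin
  b              ≡⟨ divide b ⟨
  1/ a * (a * b) ≡⟨ cong (1/ a *_) ab≡ac ⟩
  1/ a * (a * c) ≡⟨ divide c ⟩
  c              ∎
  where
  instance _ = ≢-nonZero a≢0
  divide : ∀ d → 1/ a * (a * d) ≡ d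
  divide d = trans (sym (ℚ.*-assoc (1/ a) a d)) (trans (cong (_* d) (ℚ.*-inverseˡ a)) (ℚ.*-identityˡ d))

-- Matrix algebra

≈-sym : {A B : Matrix m n} → A ≈ B → B ≈ A
≈-sym A≈B i j = sym (A≈B i j)

≈-trans : {A B C : Matrix m n} → A ≈ B → B ≈ C → A ≈ C
≈-trans A≈B B≈C i j = trans (A≈B i j) (B≈C i j)

I-diagonal : (i : Fin n) → I n i i ≡ 1ℚ
I-diagonal i rewrite dec-true (i ≟ i) refl = refl

I-offDiagonal : {i j : Fin n} → i ≢ j → I n i j ≡ 0ℚ
I-offDiagonal {i = i} {j} i≢j rewrite dec-false (i ≟ j) i≢j = refl

I-sym : (i j : Fin n) → I n i j ≡ I n j i
I-sym i j with i ≟ j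
... | yes refl = sym (I-diagonal i)
... | no  i≢j  = sym (I-offDiagonal (i≢j ∘ sym))

I≡1⇒≡ : {i j : Fin n} → I n i j ≡ 1ℚ → i ≡ j
I≡1⇒≡ {i = i} {j} eq with i ≟ j
... | yes i≡j = i≡j
... | no  _   = contradiction (sym eq) ℚ.1≢0

I-zeroOne : (i j : Fin n) → I n i j ≡ 0ℚ ⊎ I n i j ≡ 1ℚ
I-zeroOne i j with i ≟ j
... | yes _ = inj₂ refl
... | no  _ = inj₁ refl

sum-I* : (i : Fin n) (f : Vector ℚ n) → sum (λ j → I n i j * f j) ≡ f i
sum-I* zero f =
  trans (cong₂ _+_ (ℚ.*-identityˡ (f zero)) (sum-zero _ (ℚ.*-zeroˡ ∘ f ∘ suc))) (ℚ.+-identityʳ _)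
sum-I* (suc i) f =
  trans (cong₂ _+_ (ℚ.*-zeroˡ (f zero)) (sum-I* i (f ∘ suc))) (ℚ.+-identityˡ _)

sum-I : (i : Fin n) → sum (I n i) ≡ 1ℚ
sum-I {n} i = trans (sum-cong-≗ (λ j → sym (ℚ.*-identityʳ (I n i j)))) (sum-I* i (λ _ → 1ℚ))

I∙ : (A : Matrix m n) → I m ∙ A ≈ A
I∙ A i j = sum-I* i (λ k → A k j)

∙I : (A : Matrix m n) → A ∙ I n ≈ A
∙I {n = n} A i j = trans
  (sum-cong-≗ λ k → trans (ℚ.*-comm (A i k) (I n k j)) (cong (_* A i k) (I-sym k j)))
  (sum-I* j (A i))

∙-cong : {A A′ : Matrix l m} {B B′ : Matrix m n} → A ≈ A′ → B ≈ B′ → A ∙ B ≈ A′ ∙ B′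
∙-cong A≈A′ B≈B′ i j = sum-cong-≗ λ k → cong₂ _*_ (A≈A′ i k) (B≈B′ k j)

∙-congˡ : (A : Matrix l m) {B B′ : Matrix m n} → B ≈ B′ → A ∙ B ≈ A ∙ B′
∙-congˡ A B≈B′ i j = sum-cong-≗ λ k → cong (A i k *_) (B≈B′ k j)

∙-congʳ : {A A′ : Matrix l m} (B : Matrix m n) → A ≈ A′ → A ∙ B ≈ A′ ∙ B
∙-congʳ B A≈A′ i j = sum-cong-≗ λ k → cong (_* B k j) (A≈A′ i k)

∙-assoc : (A : Matrix l m) (B : Matrix m n) (C : Matrix n p) → A ∙ B ∙ C ≈ A ∙ (B ∙ C)
∙-assoc A B C i j = begin
  sum (λ k → sum (λ h → A i h * B h k) * C k j)   ≡⟨ sum-cong-≗ (λ k → *-distribʳ-sum (C k j) (λ h → A i h * B h k)) ⟩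
  sum (λ k → sum (λ h → A i h * B h k * C k j))   ≡⟨ ∑-comm (λ k h → A i h * B h k * C k j) ⟩
  sum (λ h → sum (λ k → A i h * B h k * C k j))   ≡⟨ sum-cong-≗ (λ h → sum-cong-≗ (λ k → ℚ.*-assoc (A i h) (B h k) (C k j))) ⟩
  sum (λ h → sum (λ k → A i h * (B h k * C k j))) ≡⟨ sum-cong-≗ (λ h → *-distribˡ-sum (A i h) (λ k → B h k * C k j)) ⟨
  sum (λ h → A i h * sum (λ k → B h k * C k j))   ∎

∙-distribˡ-⊕ : (A : Matrix l m) (B C : Matrix m n) → A ∙ (B ⊕ C) ≈ A ∙ B ⊕ A ∙ C
∙-distribˡ-⊕ A B C i j = trans
  (sum-cong-≗ λ k → ℚ.*-distribˡ-+ (A i k) (B k j) (C k j))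
  (∑-distrib-+ (λ k → A i k * B k j) (λ k → A i k * C k j))

∙-distribʳ-⊕ : (C : Matrix m n) (A B : Matrix l m) → (A ⊕ B) ∙ C ≈ A ∙ C ⊕ B ∙ C
∙-distribʳ-⊕ C A B i j = trans
  (sum-cong-≗ λ k → ℚ.*-distribʳ-+ (C k j) (A i k) (B i k))
  (∑-distrib-+ (λ k → A i k * C k j) (λ k → B i k * C k j))

⊕-cong : {A A′ B B′ : Matrix m n} → A ≈ A′ → B ≈ B′ → A ⊕ B ≈ A′ ⊕ B′
⊕-cong A≈A′ B≈B′ i j = cong₂ _+_ (A≈A′ i j) (B≈B′ i j)

⊗-congˡ : (A : Matrix m n) {B B′ : Matrix p q} → B ≈ B′ → A ⊗ B ≈ A ⊗ B′
⊗-congˡ A B≈B′ i j = cong (A _ _ *_) (B≈B′ _ _)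

⊗-congʳ : {A A′ : Matrix m n} (B : Matrix p q) → A ≈ A′ → A ⊗ B ≈ A′ ⊗ B
⊗-congʳ B A≈A′ i j = cong (_* B _ _) (A≈A′ _ _)

⊗-∙-⊗ : (A : Matrix l m) (B : Matrix p q) (C : Matrix m n) (D : Matrix q r) →
  (A ⊗ B) ∙ (C ⊗ D) ≈ (A ∙ C) ⊗ (B ∙ D)
⊗-∙-⊗ {l} {m} {p} {q} {n} {r} A B C D i j = begin
  -- Both Kronecker products see `k` only through `remQuot {m} q k`, so the summand is by
  -- computation a function of a pair, and the sum can be split into a double sum.
  sum (λ k → F (remQuot {m} q k))
    ≡⟨ sum-combine m (λ k → F (remQuot {m} q k)) ⟩
  sum (λ b → sum (λ t → F (remQuot q (combine {m} b t))))
    ≡⟨ sum-cong-≗ (λ b → sum-cong-≗ λ t → cong F (remQuot-combine b t)) ⟩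
  sum (λ b → sum (λ t → A i₁ b * B i₂ t * (C b j₁ * D t j₂)))
    ≡⟨ sum-cong-≗ (λ b → sum-cong-≗ λ t → interchange (A i₁ b) (B i₂ t) (C b j₁) (D t j₂)) ⟩
  sum (λ b → sum (λ t → A i₁ b * C b j₁ * (B i₂ t * D t j₂)))
    ≡⟨ sum-cong-≗ (λ b → *-distribˡ-sum (A i₁ b * C b j₁) (λ t → B i₂ t * D t j₂)) ⟨
  sum (λ b → A i₁ b * C b j₁ * sum (λ t → B i₂ t * D t j₂))
    ≡⟨ *-distribʳ-sum (sum (λ t → B i₂ t * D t j₂)) (λ b → A i₁ b * C b j₁) ⟨
  sum (λ b → A i₁ b * C b j₁) * sum (λ t → B i₂ t * D t j₂) ∎
  where
  i₁ = quotient {l} p i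
  i₂ = remainder {l} p i
  j₁ = quotient {n} r j
  j₂ = remainder {n} r j
  F : Fin m × Fin q → ℚ
  F (b , t) = A i₁ b * B i₂ t * (C b j₁ * D t j₂)
  interchange : ∀ a b c d → a * b * (c * d) ≡ a * c * (b * d)
  interchange = solve 4 (λ a b c d → a :* b :* (c :* d) := a :* c :* (b :* d)) refl

I⊗I : ∀ m n → I m ⊗ I n ≈ I (m ℕ.* n)
I⊗I m n i j with i ≟ j
... | yes refl = cong₂ _*_ (I-diagonal (quotient {m} n i)) (I-diagonal (remainder {m} n i))
... | no  i≢j with quotient {m} n i ≟ quotient {m} n j | remainder {m} n i ≟ remainder {m} n j
...   | no  _   | r≟r     = ℚ.*-zeroˡ (if does r≟r then 1ℚ else 0ℚ)
...   | yes _   | no  _   = refl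
...   | yes q≡q | yes r≡r = contradiction
        (trans (sym (combine-remQuot {m} n i)) (trans (cong₂ combine q≡q r≡r) (combine-remQuot {m} n j)))
        i≢j

⊗-combine : (A : Matrix m n) (B : Matrix p q) → ∀ a b c d →
  (A ⊗ B) (combine a b) (combine c d) ≡ A a c * B b d
⊗-combine {m} {n} {p} {q} A B a b c d =
  cong₂ (λ (u , v) (w , z) → A u w * B v z) (remQuot-combine {m} {p} a b) (remQuot-combine {n} {q} c d)

-- Linear combinations

infixr 7 _•_
_•_ : ℚ → Matrix m n → Matrix m n
(a • A) i j = a * A i j

module _ (S : Vector (Matrix m n) r) where

  isLC-resp-≈ : {M N : Matrix m n} → M ≈ N → IsLinearCombinationOf N S → IsLinearCombinationOf M S
  isLC-resp-≈ M≈N (c , N≈) = c , ≈-trans M≈N N≈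

  isLC-member : ∀ i → IsLinearCombinationOf (S i) S
  isLC-member i = I r i , λ a b → sym (sum-I* i (λ k → S k a b))

  isLC-⊕ : {M N : Matrix m n} →
    IsLinearCombinationOf M S → IsLinearCombinationOf N S → IsLinearCombinationOf (M ⊕ N) S
  isLC-⊕ (c , M≈) (d , N≈) = (λ k → c k + d k) , λ a b → begin
    _ ≡⟨ cong₂ _+_ (M≈ a b) (N≈ a b) ⟩
    _ ≡⟨ ∑-distrib-+ (λ k → c k * S k a b) (λ k → d k * S k a b) ⟨
    _ ≡⟨ sum-cong-≗ (λ k → ℚ.*-distribʳ-+ (S k a b) (c k) (d k)) ⟨
    _ ∎

  isLC-• : ∀ e {M : Matrix m n} → IsLinearCombinationOf M S → IsLinearCombinationOf (e • M) S
  isLC-• e (c , M≈) = (λ k → e * c k) , λ a b → begin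
    _ ≡⟨ cong (e *_) (M≈ a b) ⟩
    _ ≡⟨ *-distribˡ-sum e (λ k → c k * S k a b) ⟩
    _ ≡⟨ sum-cong-≗ (λ k → ℚ.*-assoc e (c k) (S k a b)) ⟨
    _ ∎

-- The dihedral group

-- The Klein four-group on the points: y, x² and x²y are a ⊻_ for a = 1, 2, 3.
infixl 6 _⊻_
_⊻_ : Fin 4 → Fin 4 → Fin 4
0F ⊻ b = b
1F ⊻ b = (1F ∷ 0F ∷ 3F ∷ 2F ∷ []) b
2F ⊻ b = (2F ∷ 3F ∷ 0F ∷ 1F ∷ []) b
3F ⊻ b = (3F ∷ 2F ∷ 1F ∷ 0F ∷ []) b

rotate : Fin 4 → Fin 4
rotate = 1F ∷ 2F ∷ 3F ∷ 0F ∷ []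

-- Conjugation by x on the Klein four-group.
φ : Fin 4 → Fin 4
φ = 0F ∷ 3F ∷ 2F ∷ 1F ∷ []

⊻-assoc : ∀ a b c → a ⊻ (b ⊻ c) ≡ a ⊻ b ⊻ c
⊻-assoc = from-yes (all? λ a → all? λ b → all? λ c → a ⊻ (b ⊻ c) ≟ a ⊻ b ⊻ c)

⊻-comm : ∀ a b → a ⊻ b ≡ b ⊻ a
⊻-comm = from-yes (all? λ a → all? λ b → a ⊻ b ≟ b ⊻ a)

⊻-identityʳ : ∀ a → a ⊻ 0F ≡ a
⊻-identityʳ a = ⊻-comm a 0F

⊻-cancelʳ : ∀ a b c → a ⊻ c ≡ b ⊻ c → a ≡ b
⊻-cancelʳ a b c a⊻c≡b⊻c = begin
  a         ≡⟨ involutive a c ⟨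
  a ⊻ c ⊻ c ≡⟨ cong (_⊻ c) a⊻c≡b⊻c ⟩
  b ⊻ c ⊻ c ≡⟨ involutive b c ⟩
  b         ∎
  where
  involutive : ∀ a c → a ⊻ c ⊻ c ≡ a
  involutive = from-yes (all? λ a → all? λ c → a ⊻ c ⊻ c ≟ a)

-- Normality of the Klein four-group, read on points. It lets every `rotate` move inwards in a
-- composite, at the price of a `φ`.
rotate-⊻ : ∀ a i → rotate (a ⊻ i) ≡ φ a ⊻ rotate i
rotate-⊻ = from-yes (all? λ a → all? λ i → rotate (a ⊻ i) ≟ φ a ⊻ rotate i)

rotate-rotate : ∀ i → rotate (rotate i) ≡ 2F ⊻ i
rotate-rotate = from-yes (all? λ i → rotate (rotate i) ≟ 2F ⊻ i)

permutation : Vector (Fin n) n → Matrix n n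
permutation {n} π i j = I n (π i) j

permutation-cong : {π τ : Vector (Fin n) n} → (∀ i → π i ≡ τ i) → permutation π ≈ permutation τ
permutation-cong {n} π≗τ i j = cong (λ k → I n k j) (π≗τ i)

permutation-injective : {π τ : Vector (Fin n) n} → permutation π ≈ permutation τ → ∀ i → π i ≡ τ i
permutation-injective {π = π} {τ} eq i = I≡1⇒≡ (trans (eq i (τ i)) (I-diagonal (τ i)))

-- Row `i` has its 1 in column `π i`, so matrix products compose from left to right. Hence the code
-- of the second factor comes first in the multiplication rules for `h` and `g`.
permutation-∙ : (π τ : Vector (Fin n) n) → permutation π ∙ permutation τ ≈ permutation (τ ∘ π)
permutation-∙ {n} π τ i j = sum-I* (π i) (λ k → I n (τ k) j)

-- h a and g a list the elements of H and of its coset xH.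
h g : Fin 4 → Matrix 4 4
h a = permutation (a ⊻_)
g a = permutation λ i → a ⊻ rotate i

h∙h : ∀ a b → h a ∙ h b ≈ h (b ⊻ a)
h∙h a b = ≈-trans (permutation-∙ (a ⊻_) (b ⊻_)) (permutation-cong (⊻-assoc b a))

h∙g : ∀ a b → h a ∙ g b ≈ g (b ⊻ φ a)
h∙g a b = ≈-trans (permutation-∙ (a ⊻_) (λ i → b ⊻ rotate i)) $ permutation-cong λ i →
  trans (cong (b ⊻_) (rotate-⊻ a i)) (⊻-assoc b (φ a) (rotate i))

g∙h : ∀ a b → g a ∙ h b ≈ g (b ⊻ a)
g∙h a b = ≈-trans (permutation-∙ (λ i → a ⊻ rotate i) (b ⊻_)) $ permutation-cong λ i →
  ⊻-assoc b a (rotate i)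

g∙g : ∀ a b → g a ∙ g b ≈ h (b ⊻ φ a ⊻ 2F)
g∙g a b = ≈-trans (permutation-∙ (λ i → a ⊻ rotate i) (λ i → b ⊻ rotate i)) $ permutation-cong λ i → begin
  b ⊻ rotate (a ⊻ rotate i)     ≡⟨ cong (b ⊻_) (rotate-⊻ a (rotate i)) ⟩
  b ⊻ (φ a ⊻ rotate (rotate i)) ≡⟨ ⊻-assoc b (φ a) _ ⟩
  b ⊻ φ a ⊻ rotate (rotate i)   ≡⟨ cong (b ⊻ φ a ⊻_) (rotate-rotate i) ⟩
  b ⊻ φ a ⊻ (2F ⊻ i)            ≡⟨ ⊻-assoc (b ⊻ φ a) 2F i ⟩
  b ⊻ φ a ⊻ 2F ⊻ i              ∎

infix 4 _≈?_
_≈?_ : (A B : Matrix m n) → Dec (A ≈ B)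
A ≈? B = all? λ i → all? λ j → A i j ℚ.≟ B i j

1≈h : I 4 ≈ h 0F
1≈h i j = refl

y≈h : y ≈ h 1F
y≈h = from-yes (y ≈? h 1F)

x≈g : x ≈ g 0F
x≈g = from-yes (x ≈? g 0F)

x²≈h : x ∙ x ≈ h 2F
x²≈h = ≈-trans (∙-cong x≈g x≈g) (g∙g 0F 0F)

x²y≈h : x ∙ x ∙ y ≈ h 3F
x²y≈h = ≈-trans (∙-cong x²≈h y≈h) (h∙h 2F 1F)

-- Codes of the group elements, split so that the constructor decides membership in the centralizer
-- of `y`: `inj₁` for H, `inj₂` for xH.
D₈ : Set
D₈ = Fin 4 ⊎ Fin 4

⟦_⟧ : D₈ → Matrix 4 4
⟦_⟧ = [ h , g ]′

infixl 7 _·_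
_·_ : D₈ → D₈ → D₈
inj₁ a · inj₁ b = inj₁ (b ⊻ a)
inj₁ a · inj₂ b = inj₂ (b ⊻ φ a)
inj₂ a · inj₁ b = inj₂ (b ⊻ a)
inj₂ a · inj₂ b = inj₁ (b ⊻ φ a ⊻ 2F)

⟦⟧-∙ : ∀ e f → ⟦ e ⟧ ∙ ⟦ f ⟧ ≈ ⟦ e · f ⟧
⟦⟧-∙ (inj₁ a) (inj₁ b) = h∙h a b
⟦⟧-∙ (inj₁ a) (inj₂ b) = h∙g a b
⟦⟧-∙ (inj₂ a) (inj₁ b) = g∙h a b
⟦⟧-∙ (inj₂ a) (inj₂ b) = g∙g a b

-- On the coset the code solves `b ⊻ φ a ⊻ 2F ≡ 0F` for `b`. The same code occurs in `ᵗg`, because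
-- the inverse of a permutation matrix is its transpose.
_⁻¹ : D₈ → D₈
inj₁ a ⁻¹ = inj₁ a
inj₂ a ⁻¹ = inj₂ (φ a ⊻ 2F)

·-inverseˡ : ∀ e → e ⁻¹ · e ≡ inj₁ 0F
·-inverseˡ (inj₁ a) = cong inj₁ (from-yes (all? λ a → a ⊻ a ≟ 0F) a)
·-inverseˡ (inj₂ a) = cong inj₁ (from-yes (all? λ a → a ⊻ φ (φ a ⊻ 2F) ⊻ 2F ≟ 0F) a)

G⇒⟦⟧ : ∀ {M} → M ∈ G → ∃[ e ] M ≈ ⟦ e ⟧
G⇒⟦⟧ x∈G = inj₂ 0F , x≈g
G⇒⟦⟧ y∈G = inj₁ 1F , y≈h
G⇒⟦⟧ 1∈G = inj₁ 0F , 1≈h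
G⇒⟦⟧ (∙-closed M∈G N∈G) =
  let e , M≈e = G⇒⟦⟧ M∈G
      f , N≈f = G⇒⟦⟧ N∈G
  in e · f , ≈-trans (∙-cong M≈e N≈f) (⟦⟧-∙ e f)
-- `N` is an arbitrary matrix known only through its equations with `M`. Multiplying `M ∙ N ≈ I 4`
-- on the left by the coded inverse of `M` identifies it.
G⇒⟦⟧ (⁻¹-closed {M} {N} M∈G MN≈1 _) =
  let e , M≈e = G⇒⟦⟧ M∈G in e ⁻¹ , λ i j → begin
    N i j                    ≡⟨ I∙ N i j ⟨
    (I 4 ∙ N) i j            ≡⟨ ∙-congʳ N (e⁻¹M≈1 e M≈e) i j ⟨
    (⟦ e ⁻¹ ⟧ ∙ M ∙ N) i j   ≡⟨ ∙-assoc ⟦ e ⁻¹ ⟧ M N i j ⟩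
    (⟦ e ⁻¹ ⟧ ∙ (M ∙ N)) i j ≡⟨ ∙-congˡ ⟦ e ⁻¹ ⟧ MN≈1 i j ⟩
    (⟦ e ⁻¹ ⟧ ∙ I 4) i j     ≡⟨ ∙I ⟦ e ⁻¹ ⟧ i j ⟩
    ⟦ e ⁻¹ ⟧ i j             ∎
  where
  e⁻¹M≈1 : ∀ e → M ≈ ⟦ e ⟧ → ⟦ e ⁻¹ ⟧ ∙ M ≈ I 4
  e⁻¹M≈1 e M≈e = ≈-trans (∙-congˡ ⟦ e ⁻¹ ⟧ M≈e)
    (≈-trans (⟦⟧-∙ (e ⁻¹) e) λ i j → cong (λ f → ⟦ f ⟧ i j) (·-inverseˡ e))
G⇒⟦⟧ (≈-closed M∈G M≈N) =
  let e , M≈e = G⇒⟦⟧ M∈G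
  in e , ≈-trans (≈-sym M≈N) M≈e

h∈G : ∀ a → h a ∈ G
h∈G 0F = ≈-closed 1∈G 1≈h
h∈G 1F = ≈-closed y∈G y≈h
h∈G 2F = ≈-closed (∙-closed x∈G x∈G) x²≈h
h∈G 3F = ≈-closed (∙-closed (∙-closed x∈G x∈G) y∈G) x²y≈h

g∈G : ∀ a → g a ∈ G
g∈G a = ≈-closed (∙-closed (≈-closed x∈G x≈g) (h∈G a))
  (≈-trans (g∙h 0F a) (permutation-cong λ i → cong (_⊻ rotate i) (⊻-identityʳ a)))

≈h⇒H : ∀ {M} a → M ≈ h a → M ∈ H
≈h⇒H {M} a M≈h = ≈-closed (h∈G a) (≈-sym M≈h) , commutes
  where
  commutes : M ∙ y ≈ y ∙ M
  commutes i j = begin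
    (M ∙ y) i j      ≡⟨ ∙-cong M≈h y≈h i j ⟩
    (h a ∙ h 1F) i j ≡⟨ h∙h a 1F i j ⟩
    h (1F ⊻ a) i j   ≡⟨ cong (λ b → h b i j) (⊻-comm 1F a) ⟩
    h (a ⊻ 1F) i j   ≡⟨ h∙h 1F a i j ⟨
    (h 1F ∙ h a) i j ≡⟨ ∙-cong y≈h M≈h i j ⟨
    (y ∙ M) i j      ∎

-- On the coset, multiplication by `y` from the right adds 1F to the code, and from the left adds
-- `φ 1F`, which is 3F. The resulting permutations differ already at the point 0F, so no element of
-- the coset centralizes `y`.
≈g⇒∉H : ∀ {M} a → M ≈ g a → M ∉ H
≈g⇒∉H {M} a M≈g (_ , My≈yM) =
  from-yes (all? λ a → ¬? (1F ⊻ a ⊻ rotate 0F ≟ a ⊻ 3F ⊻ rotate 0F)) a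
    (permutation-injective {π = λ i → 1F ⊻ a ⊻ rotate i} {τ = λ i → a ⊻ 3F ⊻ rotate i} g≈g 0F)
  where
  g≈g : g (1F ⊻ a) ≈ g (a ⊻ 3F)
  g≈g i j = begin
    g (1F ⊻ a) i j   ≡⟨ g∙h a 1F i j ⟨
    (g a ∙ h 1F) i j ≡⟨ ∙-cong M≈g y≈h i j ⟨
    (M ∙ y) i j      ≡⟨ My≈yM i j ⟩
    (y ∙ M) i j      ≡⟨ ∙-cong y≈h M≈g i j ⟩
    (h 1F ∙ g a) i j ≡⟨ h∙g 1F a i j ⟩
    g (a ⊻ 3F) i j   ∎

H⇒≈h : ∀ {M} → M ∈ H → ∃[ a ] M ≈ h a
H⇒≈h M∈H with G⇒⟦⟧ (proj₁ M∈H)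
... | inj₁ a , M≈h = a , M≈h
... | inj₂ a , M≈g = contradiction M∈H (≈g⇒∉H a M≈g)

G∖H⇒≈g : ∀ {M} → M ∈ G∖H → ∃[ a ] M ≈ g a
G∖H⇒≈g (M∈G , M∉H) with G⇒⟦⟧ M∈G
... | inj₁ a , M≈h = contradiction (≈h⇒H a M≈h) M∉H
... | inj₂ a , M≈g = a , M≈g

sum-h : ∀ i j → sum (λ a → h a i j) ≡ 1ℚ
sum-h = from-yes (all? λ i → all? λ j → sum (λ a → h a i j) ℚ.≟ 1ℚ)

sum-g : ∀ c i j → sum (λ a → g (c ⊻ a) i j) ≡ 1ℚ
sum-g = from-yes (all? λ c → all? λ i → all? λ j → sum (λ a → g (c ⊻ a) i j) ℚ.≟ 1ℚ)

h-symmetric : ∀ a → ᵗ h a ≈ h a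
h-symmetric = from-yes (all? λ a → ᵗ h a ≈? h a)

ᵗg : ∀ a → ᵗ g a ≈ g (φ a ⊻ 2F)
ᵗg = from-yes (all? λ a → ᵗ g a ≈? g (φ a ⊻ 2F))

-- x + x³ = y + x²y and xy + x³y = 1 + x², multiplied by the elements of H.
g⊕g≈h⊕h : ∀ a c → g (c ⊻ a) ⊕ g (c ⊻ (a ⊻ 2F)) ≈ h (c ⊻ 1F ⊻ a) ⊕ h (c ⊻ 3F ⊻ a)
g⊕g≈h⊕h = from-yes (all? λ a → all? λ c →
  (g (c ⊻ a) ⊕ g (c ⊻ (a ⊻ 2F))) ≈? (h (c ⊻ 1F ⊻ a) ⊕ h (c ⊻ 3F ⊻ a)))

-- Non-symmetric schemes of rank 3

-- The values at one position of four 0/1 matrices with sum J, in the order identity, `E`, `A`, `B`.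
-- As a type of cases, disjointness and idempotence follow by matching. Before bordering there is no
-- `E`, and its slot is held at 0ℚ.
data OneHot : ℚ → ℚ → ℚ → ℚ → Set where
  hot₀ : OneHot 1ℚ 0ℚ 0ℚ 0ℚ
  hot₁ : OneHot 0ℚ 1ℚ 0ℚ 0ℚ
  hot₂ : OneHot 0ℚ 0ℚ 1ℚ 0ℚ
  hot₃ : OneHot 0ℚ 0ℚ 0ℚ 1ℚ

oneHot-swap : ∀ {a b c d} → OneHot a b c d → OneHot a b d c
oneHot-swap hot₀ = hot₀
oneHot-swap hot₁ = hot₁
oneHot-swap hot₂ = hot₃
oneHot-swap hot₃ = hot₂

oneHot-sum : ∀ {a b c d} → OneHot a b c d → a + (b + c + d) ≡ 1ℚ
oneHot-sum hot₀ = refl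
oneHot-sum hot₁ = refl
oneHot-sum hot₂ = refl
oneHot-sum hot₃ = refl

oneHot-idem : ∀ {a b c d} → OneHot a b c d → c * c ≡ c
oneHot-idem hot₀ = refl
oneHot-idem hot₁ = refl
oneHot-idem hot₂ = refl
oneHot-idem hot₃ = refl

oneHot-nonneg : ∀ {a b c d} → OneHot a b c d → 0ℚ ≤ c
oneHot-nonneg hot₀ = ℚ.≤-refl
oneHot-nonneg hot₁ = ℚ.≤-refl
oneHot-nonneg hot₂ = from-yes (0ℚ ℚ.≤? 1ℚ)
oneHot-nonneg hot₃ = ℚ.≤-refl

oneHot-first : ∀ {a b c d} → OneHot a b c d → a ≡ 1ℚ → c ≡ 0ℚ × d ≡ 0ℚ
oneHot-first hot₀ _ = refl , refl

oneHot-third : ∀ {a b c d} → OneHot a b c d → c ≡ 1ℚ → a ≡ 0ℚ × d ≡ 0ℚ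
oneHot-third hot₂ _ = refl , refl

zeroOne⇒oneHot : ∀ {a c d} → a ≡ 0ℚ ⊎ a ≡ 1ℚ → c ≡ 0ℚ ⊎ c ≡ 1ℚ → d ≡ 0ℚ ⊎ d ≡ 1ℚ →
  a + (c + (d + 0ℚ)) ≡ 1ℚ → OneHot a 0ℚ c d
zeroOne⇒oneHot (inj₂ refl) (inj₁ refl) (inj₁ refl) _ = hot₀
zeroOne⇒oneHot (inj₁ refl) (inj₂ refl) (inj₁ refl) _ = hot₂
zeroOne⇒oneHot (inj₁ refl) (inj₁ refl) (inj₂ refl) _ = hot₃
zeroOne⇒oneHot (inj₁ refl) (inj₁ refl) (inj₁ refl) ()
zeroOne⇒oneHot (inj₁ refl) (inj₂ refl) (inj₂ refl) ()
zeroOne⇒oneHot (inj₂ refl) (inj₂ refl) (inj₁ refl) ()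
zeroOne⇒oneHot (inj₂ refl) (inj₁ refl) (inj₂ refl) ()
zeroOne⇒oneHot (inj₂ refl) (inj₂ refl) (inj₂ refl) ()

-- A pair of matrices that may serve as the non-identity members of such a scheme.
record TransposePair {m} (A B : Matrix m m) : Set where
  field
    complementary : ∀ i j → OneHot (I m i j) 0ℚ (A i j) (B i j)
    transposed    : B ≈ ᵗ A
    product       : ∃[ c₀ ] ∃[ c₁ ] ∃[ c₂ ] A ∙ B ≈ c₀ • I m ⊕ c₁ • A ⊕ c₂ • B
    nonempty      : ∃₂ λ i j → A i j ≡ 1ℚ

  -- A ∙ B = A ∙ ᵗ A is symmetric, so A and B have equal coefficients in it, and
  -- its diagonal consists of the row sums of A.
  gram : ∃₂ λ c d → (∀ i → sum (A i) ≡ c) × A ∙ B ≈ c • I m ⊕ d • (A ⊕ B)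
  gram with product | nonempty
  ... | c₀ , c₁ , c₂ , AB≈ | p , q , Apq≡1 = c₀ , c₁ , rowSum , λ i j → begin
    (A ∙ B) i j                              ≡⟨ AB≈ i j ⟩
    c₀ * I m i j + c₁ * A i j + c₂ * B i j   ≡⟨ cong (λ c → c₀ * I m i j + c₁ * A i j + c * B i j) c₁≡c₂ ⟨
    c₀ * I m i j + c₁ * A i j + c₁ * B i j   ≡⟨ factor c₁ (c₀ * I m i j) (A i j) (B i j) ⟩
    c₀ * I m i j + c₁ * (A i j + B i j)      ∎
    where
    factor : ∀ c u a b → u + c * a + c * b ≡ u + c * (a + b)
    factor = solve 4 (λ c u a b → u :+ c :* a :+ c :* b := u :+ c :* (a :+ b)) refl

    entry : ∀ {i j u a b} → I m i j ≡ u → A i j ≡ a → B i j ≡ b → (A ∙ B) i j ≡ c₀ * u + c₁ * a + c₂ * b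
    entry {i} {j} refl refl refl = AB≈ i j

    AB-sym : ∀ i j → (A ∙ B) i j ≡ (A ∙ B) j i
    AB-sym i j = sum-cong-≗ λ k → begin
      A i k * B k j ≡⟨ cong (A i k *_) (transposed k j) ⟩
      A i k * A j k ≡⟨ ℚ.*-comm (A i k) (A j k) ⟩
      A j k * A i k ≡⟨ cong (A j k *_) (transposed k i) ⟨
      A j k * B k i ∎

    -- At (p, q) only `A` is 1 and the combination reads off `c₁`; at (q, p) only `B` is 1 and it
    -- reads off `c₂`.
    c₁≡c₂ : c₁ ≡ c₂
    c₁≡c₂ = begin
      c₁                              ≡⟨ solve 3 (λ c₀ c₁ c₂ → c₁ := c₀ :* con 0ℚ :+ c₁ :* con 1ℚ :+ c₂ :* con 0ℚ) refl c₀ c₁ c₂ ⟩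
      c₀ * 0ℚ + c₁ * 1ℚ + c₂ * 0ℚ     ≡⟨ entry Ipq≡0 Apq≡1 Bpq≡0 ⟨
      (A ∙ B) p q                     ≡⟨ AB-sym p q ⟩
      (A ∙ B) q p                     ≡⟨ entry (trans (I-sym q p) Ipq≡0) (trans (sym (transposed p q)) Bpq≡0) (trans (transposed q p) Apq≡1) ⟩
      c₀ * 0ℚ + c₁ * 0ℚ + c₂ * 1ℚ     ≡⟨ solve 3 (λ c₀ c₁ c₂ → c₀ :* con 0ℚ :+ c₁ :* con 0ℚ :+ c₂ :* con 1ℚ := c₂) refl c₀ c₁ c₂ ⟩
      c₂                              ∎
      where
      Ipq≡0 = proj₁ (oneHot-third (complementary p q) Apq≡1)
      Bpq≡0 = proj₂ (oneHot-third (complementary p q) Apq≡1)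

    rowSum : ∀ i → sum (A i) ≡ c₀
    rowSum i = begin
      sum (A i)                       ≡⟨ sum-cong-≗ (λ k → oneHot-idem (complementary i k)) ⟨
      sum (λ k → A i k * A i k)       ≡⟨ sum-cong-≗ (λ k → cong (A i k *_) (transposed k i)) ⟨
      (A ∙ B) i i                     ≡⟨ entry (I-diagonal i) (proj₁ Aii≡0) (proj₂ Aii≡0) ⟩
      c₀ * 1ℚ + c₁ * 0ℚ + c₂ * 0ℚ     ≡⟨ solve 3 (λ c₀ c₁ c₂ → c₀ :* con 1ℚ :+ c₁ :* con 0ℚ :+ c₂ :* con 0ℚ := c₀) refl c₀ c₁ c₂ ⟩
      c₀                              ∎
      where Aii≡0 = oneHot-first (complementary i i) (I-diagonal i)

-- The adjacency matrices of a doubly regular tournament of valency k.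
record DoublyRegular {m} (A B : Matrix m m) : Set where
  field
    complementary : ∀ i j → OneHot (I m i j) 0ℚ (A i j) (B i j)
    transposed    : B ≈ ᵗ A
    nonempty      : ∃₂ λ i j → A i j ≡ 1ℚ
    k             : ℚ
    order         : sum {m} (λ _ → 1ℚ) ≡ 1ℚ + k + k
    rowSumA       : ∀ i → sum (A i) ≡ k
    rowSumB       : ∀ i → sum (B i) ≡ k
    mixed         : ∀ i j → (A ∙ B) i j + (B ∙ A) i j + (A i j + B i j) ≡ (k + k) * I m i j + k * (A i j + B i j)
    squares       : ∀ i j → (A ∙ A) i j + (B ∙ B) i j ≡ k * (A i j + B i j)

-- The Gram identities of `A ∙ B` and `B ∙ A` arrive with constants `k`, `d` and `k′`, `d′` that are
-- a priori unrelated. Counting the ones of `A` by rows and by columns identifies the valencies, and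
-- row sums of the products then determine `d` and `d′`.
module Counting {A B : Matrix m m} (AB : TransposePair A B) {k k′ d d′ : ℚ}
  (rowSumA : ∀ i → sum (A i) ≡ k) (AB≈ : A ∙ B ≈ k • I m ⊕ d • (A ⊕ B))
  (rowSumB′ : ∀ i → sum (B i) ≡ k′) (BA≈ : B ∙ A ≈ k′ • I m ⊕ d′ • (B ⊕ A)) where

  open TransposePair AB using (complementary; transposed; nonempty)

  -- A vertex `v` with an arc to `w`: its existence makes the order nonzero, and the arc makes the
  -- valency nonzero.
  v = proj₁ nonempty
  w = proj₁ (proj₂ nonempty)

  N : ℚ
  N = sum {m} (λ _ → 1ℚ)

  0≤1 : 0ℚ ≤ 1ℚ
  0≤1 = from-yes (0ℚ ℚ.≤? 1ℚ)

  N≢0 : N ≢ 0ℚ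
  N≢0 = 1≤⇒≢0 (term≤sum {m} (λ _ → 1ℚ) (λ _ → 0≤1) v)

  k≢0 : k ≢ 0ℚ
  k≢0 = 1≤⇒≢0 (subst (1ℚ ≤_) (rowSumA v) (subst (_≤ sum (A v)) (proj₂ (proj₂ nonempty))
    (term≤sum (A v) (λ j → oneHot-nonneg (complementary v j)) w)))

  sum-const : ∀ c → sum {m} (λ _ → c) ≡ c * N
  sum-const c = trans (sum-cong-≗ {m} λ _ → sym (ℚ.*-identityʳ c)) (sym (*-distribˡ-sum {m} c (λ _ → 1ℚ)))

  -- Both sides count the entries 1 of A.
  k≡k′ : k ≡ k′
  k≡k′ = *-cancelˡ N≢0 $ begin
    N * k                           ≡⟨ ℚ.*-comm N k ⟩
    k * N                           ≡⟨ sum-const k ⟨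
    sum {m} (λ _ → k)               ≡⟨ sum-cong-≗ rowSumA ⟨
    sum (λ i → sum (λ j → A i j))   ≡⟨ ∑-comm A ⟩
    sum (λ j → sum (λ i → A i j))   ≡⟨ sum-cong-≗ (λ j → sum-cong-≗ (transposed j)) ⟨
    sum (λ j → sum (B j))           ≡⟨ sum-cong-≗ rowSumB′ ⟩
    sum {m} (λ _ → k′)              ≡⟨ sum-const k′ ⟩
    k′ * N                          ≡⟨ ℚ.*-comm k′ N ⟩
    N * k′                          ∎

  rowSumB : ∀ i → sum (B i) ≡ k
  rowSumB i = trans (rowSumB′ i) (sym k≡k′)

  total : ∀ i j → I m i j + (A i j + B i j) ≡ 1ℚ
  total i j = trans (cong (λ a → I m i j + (a + B i j)) (sym (ℚ.+-identityˡ (A i j)))) (oneHot-sum (complementary i j))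

  sum-A+B : ∀ i → sum (λ j → A i j + B i j) ≡ k + k
  sum-A+B i = trans (∑-distrib-+ (A i) (B i)) (cong₂ _+_ (rowSumA i) (rowSumB i))

  order : N ≡ 1ℚ + k + k
  order = begin
    N                                               ≡⟨ sum-cong-≗ (total v) ⟨
    sum (λ j → I m v j + (A v j + B v j))           ≡⟨ ∑-distrib-+ (I m v) (λ j → A v j + B v j) ⟩
    sum (I m v) + sum (λ j → A v j + B v j)         ≡⟨ cong₂ _+_ (sum-I v) (sum-A+B v) ⟩
    1ℚ + (k + k)                                    ≡⟨ ℚ.+-assoc 1ℚ k k ⟨
    1ℚ + k + k                                      ∎

  -- Compare the row sums of both sides of C ∙ D = k I + e (A + B).
  valency : (C D : Matrix m m) (e : ℚ) → (∀ i → sum (C i) ≡ k) → (∀ i → sum (D i) ≡ k) →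
    (∀ i j → (C ∙ D) i j ≡ k * I m i j + e * (A i j + B i j)) → k ≡ 1ℚ + (e + e)
  valency C D e rowSumC rowSumD CD≈ = *-cancelˡ k≢0 $ begin
    k * k                                         ≡⟨ cong (_* k) (rowSumC v) ⟨
    sum (C v) * k                                 ≡⟨ *-distribʳ-sum k (C v) ⟩
    sum (λ l → C v l * k)                         ≡⟨ sum-cong-≗ (λ l → cong (C v l *_) (rowSumD l)) ⟨
    sum (λ l → C v l * sum (D l))                 ≡⟨ sum-cong-≗ (λ l → *-distribˡ-sum (C v l) (D l)) ⟩
    sum (λ l → sum (λ j → C v l * D l j))         ≡⟨ ∑-comm (λ l j → C v l * D l j) ⟩
    sum (λ j → (C ∙ D) v j)                       ≡⟨ sum-cong-≗ (CD≈ v) ⟩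
    sum (λ j → k * I m v j + e * (A v j + B v j)) ≡⟨ ∑-distrib-+ (λ j → k * I m v j) (λ j → e * (A v j + B v j)) ⟩
    sum (λ j → k * I m v j) + sum (λ j → e * (A v j + B v j))
      ≡⟨ cong₂ _+_ (*-distribˡ-sum k (I m v)) (*-distribˡ-sum e (λ j → A v j + B v j)) ⟨
    k * sum (I m v) + e * sum (λ j → A v j + B v j)
      ≡⟨ cong₂ (λ a b → k * a + e * b) (sum-I v) (sum-A+B v) ⟩
    k * 1ℚ + e * (k + k)
      ≡⟨ solve 2 (λ k e → k :* con 1ℚ :+ e :* (k :+ k) := k :* (con 1ℚ :+ (e :+ e))) refl k e ⟩
    k * (1ℚ + (e + e))                            ∎

  BA≈′ : ∀ i j → (B ∙ A) i j ≡ k * I m i j + d′ * (A i j + B i j)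
  BA≈′ i j = trans (BA≈ i j) (cong₂ (λ c s → c * I m i j + d′ * s) (sym k≡k′) (ℚ.+-comm (B i j) (A i j)))

  half : ∀ e → k ≡ 1ℚ + (e + e) → e ≡ ½ * (k - 1ℚ)
  half e refl = solve 1 (λ e → e := con ½ :* (con 1ℚ :+ (e :+ e) :- con 1ℚ)) refl e

  -- By `valency`, both `d` and `d′` solve k = 1 + 2e, so each is half of k - 1.
  d+d′ : 1ℚ + (d + d′) ≡ k
  d+d′ = begin
    1ℚ + (d + d′)                           ≡⟨ cong₂ (λ a b → 1ℚ + (a + b)) (half d (valency A B d rowSumA rowSumB AB≈)) (half d′ (valency B A d′ rowSumB rowSumA BA≈′)) ⟩
    1ℚ + (½ * (k - 1ℚ) + ½ * (k - 1ℚ))      ≡⟨ solve 1 (λ k → con 1ℚ :+ (con ½ :* (k :- con 1ℚ) :+ con ½ :* (k :- con 1ℚ)) := k) refl k ⟩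
    k                                       ∎

  -- The term `A i j + B i j` stands on the left because the square of `E` contributes J = I + A + B
  -- to the large block, where this sum is met together with the two products.
  mixed : ∀ i j → (A ∙ B) i j + (B ∙ A) i j + (A i j + B i j) ≡ (k + k) * I m i j + k * (A i j + B i j)
  mixed i j = begin
    (A ∙ B) i j + (B ∙ A) i j + f
      ≡⟨ cong₂ (λ a b → a + b + f) (AB≈ i j) (BA≈′ i j) ⟩
    (k * u + d * f) + (k * u + d′ * f) + f
      ≡⟨ collect k d d′ u f ⟩
    (k + k) * u + (1ℚ + (d + d′)) * f
      ≡⟨ cong (λ e → (k + k) * u + e * f) d+d′ ⟩
    (k + k) * u + k * f ∎
    where
    u = I m i j
    f = A i j + B i j
    collect : ∀ k d d′ u f → (k * u + d * f) + (k * u + d′ * f) + f ≡ (k + k) * u + (1ℚ + (d + d′)) * f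
    collect = solve 5 (λ k d d′ u f →
      (k :* u :+ d :* f) :+ (k :* u :+ d′ :* f) :+ f := (k :+ k) :* u :+ (con 1ℚ :+ (d :+ d′)) :* f) refl

  -- C J = k J, where J = I + A + B.
  expand : (C : Matrix m m) → (∀ i → sum (C i) ≡ k) → ∀ i j → C i j + ((C ∙ A) i j + (C ∙ B) i j) ≡ k
  expand C rowSumC i j = begin
    C i j + ((C ∙ A) i j + (C ∙ B) i j)           ≡⟨ cong₂ _+_ (∙I C i j) (∙-distribˡ-⊕ C A B i j) ⟨
    (C ∙ I m) i j + (C ∙ (A ⊕ B)) i j             ≡⟨ ∙-distribˡ-⊕ C (I m) (A ⊕ B) i j ⟨
    sum (λ l → C i l * (I m l j + (A l j + B l j))) ≡⟨ sum-cong-≗ (λ l → trans (cong (C i l *_) (total l j)) (ℚ.*-identityʳ (C i l))) ⟩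
    sum (C i)                                     ≡⟨ rowSumC i ⟩
    k                                             ∎

  -- Adding `expand` for `A` and for `B` gives all four products plus A + B, with the value 2k in
  -- every entry. Subtracting `mixed` leaves the squares.
  squares : ∀ i j → (A ∙ A) i j + (B ∙ B) i j ≡ k * (A i j + B i j)
  squares i j = begin
    (A ∙ A) i j + (B ∙ B) i j
      ≡⟨ isolate (A i j) (B i j) ((A ∙ A) i j) ((A ∙ B) i j) ((B ∙ A) i j) ((B ∙ B) i j) ⟩
    (A i j + ((A ∙ A) i j + (A ∙ B) i j)) + (B i j + ((B ∙ A) i j + (B ∙ B) i j)) - ((A ∙ B) i j + (B ∙ A) i j + f)
      ≡⟨ cong₂ _-_ (cong₂ _+_ (expand A rowSumA i j) (expand B rowSumB i j)) (mixed i j) ⟩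
    k + k - ((k + k) * u + k * f)
      ≡⟨ cong (λ c → c - ((k + k) * u + k * f)) (trans (cong ((k + k) *_) (total i j)) (ℚ.*-identityʳ (k + k))) ⟨
    (k + k) * (u + f) - ((k + k) * u + k * f)
      ≡⟨ cancel k u f ⟩
    k * f ∎
    where
    u = I m i j
    f = A i j + B i j
    isolate : ∀ a b aa ab ba bb → aa + bb ≡ (a + (aa + ab)) + (b + (ba + bb)) - (ab + ba + (a + b))
    isolate = solve 6 (λ a b aa ab ba bb →
      aa :+ bb := (a :+ (aa :+ ab)) :+ (b :+ (ba :+ bb)) :- (ab :+ ba :+ (a :+ b))) refl
    cancel : ∀ k u f → (k + k) * (u + f) - ((k + k) * u + k * f) ≡ k * f
    cancel = solve 3 (λ k u f → (k :+ k) :* (u :+ f) :- ((k :+ k) :* u :+ k :* f) := k :* f) refl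

  gram⇒doublyRegular : DoublyRegular A B
  gram⇒doublyRegular = record
    { complementary = complementary
    ; transposed    = transposed
    ; nonempty      = nonempty
    ; k             = k
    ; order         = order
    ; rowSumA       = rowSumA
    ; rowSumB       = rowSumB
    ; mixed         = mixed
    ; squares       = squares
    }

-- Each order of the pair yields one Gram identity: the diagonal of `A ∙ B` controls the row sums of
-- `A`, that of `B ∙ A` those of `B`.
doublyRegular : {A B : Matrix m m} → TransposePair A B → TransposePair B A → DoublyRegular A B
doublyRegular AB BA =
  let k , d , rowSumA , AB≈ = TransposePair.gram AB
      k′ , d′ , rowSumB , BA≈ = TransposePair.gram BA
  in Counting.gram⇒doublyRegular AB {k} {k′} {d} {d′} rowSumA AB≈ rowSumB BA≈

-- Bordered matrices

sum-0* : (f : Vector ℚ n) → sum (λ i → 0ℚ * f i) ≡ 0ℚ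
sum-0* f = sum-zero _ (λ i → ℚ.*-zeroˡ (f i))

sum-*0 : (f : Vector ℚ n) → sum (λ i → f i * 0ℚ) ≡ 0ℚ
sum-*0 f = sum-zero _ (λ i → ℚ.*-zeroʳ (f i))

sum-1* : (f : Vector ℚ n) → sum (λ i → 1ℚ * f i) ≡ sum f
sum-1* f = sum-cong-≗ (λ i → ℚ.*-identityˡ (f i))

sum-*1 : (f : Vector ℚ n) → sum (λ i → f i * 1ℚ) ≡ sum f
sum-*1 f = sum-cong-≗ (λ i → ℚ.*-identityʳ (f i))

0+ : ∀ {a b} → a ≡ b → 0ℚ + a ≡ b
0+ a≡b = trans (ℚ.+-identityˡ _) a≡b

bordered : ℚ → ℚ → ℚ → Matrix m m → Matrix (suc m) (suc m)
bordered a b c A zero    zero    = a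
bordered a b c A zero    (suc j) = b
bordered a b c A (suc i) zero    = c
bordered a b c A (suc i) (suc j) = A i j

E∙E : ∀ m → E m ∙ E m ≈ bordered (sum {m} (λ _ → 1ℚ)) 0ℚ 0ℚ (J m)
E∙E m zero    zero    = 0+ refl
E∙E m zero    (suc j) = 0+ (sum-*0 {m} (λ _ → 1ℚ))
E∙E m (suc i) zero    = 0+ (sum-0* {m} (λ _ → 1ℚ))
E∙E m (suc i) (suc j) = trans (cong (1ℚ +_) (sum-0* {m} (λ _ → 0ℚ))) refl

pad∙pad : (A B : Matrix m m) → pad A ∙ pad B ≈ pad (A ∙ B)
pad∙pad A B zero    zero    = 0+ (sum-0* (λ k → pad B (suc k) zero))
pad∙pad A B zero    (suc j) = 0+ (sum-0* (λ k → B k j))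
pad∙pad A B (suc i) zero    = 0+ (sum-*0 (A i))
pad∙pad A B (suc i) (suc j) = 0+ refl

E∙pad : ∀ {k} (A : Matrix m m) → (∀ j → sum (λ i → A i j) ≡ k) → E m ∙ pad A ≈ bordered 0ℚ k 0ℚ (O m m)
E∙pad {m} A colSum zero    zero    = 0+ (sum-*0 {m} (λ _ → 1ℚ))
E∙pad {m} A colSum zero    (suc j) = 0+ (trans (sum-1* (λ k → A k j)) (colSum j))
E∙pad {m} A colSum (suc i) zero    = 0+ (sum-0* {m} (λ _ → 0ℚ))
E∙pad {m} A colSum (suc i) (suc j) = 0+ (sum-0* (λ k → A k j))

pad∙E : ∀ {k} (A : Matrix m m) → (∀ i → sum (A i) ≡ k) → pad A ∙ E m ≈ bordered 0ℚ 0ℚ k (O m m)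
pad∙E {m} A rowSum zero    zero    = 0+ (sum-0* {m} (λ _ → 1ℚ))
pad∙E {m} A rowSum zero    (suc j) = 0+ (sum-0* {m} (λ _ → 0ℚ))
pad∙E {m} A rowSum (suc i) zero    = 0+ (trans (sum-*1 (A i)) (rowSum i))
pad∙E {m} A rowSum (suc i) (suc j) = 0+ (sum-*0 (A i))

module Bordered {A B : Matrix m m} (AB : DoublyRegular A B) where
  open DoublyRegular AB

  hot : ∀ i j → OneHot (I (suc m) i j) (E m i j) (pad A i j) (pad B i j)
  hot zero    zero    = hot₀
  hot zero    (suc j) = hot₁
  hot (suc i) zero    = hot₁
  hot (suc i) (suc j) = complementary i j

  E-symmetric : ∀ i j → E m i j ≡ E m j i
  E-symmetric zero    zero    = refl
  E-symmetric zero    (suc j) = refl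
  E-symmetric (suc i) zero    = refl
  E-symmetric (suc i) (suc j) = refl

  ᵗpadA : ᵗ pad A ≈ pad B
  ᵗpadA zero    zero    = refl
  ᵗpadA zero    (suc j) = refl
  ᵗpadA (suc i) zero    = refl
  ᵗpadA (suc i) (suc j) = sym (transposed i j)

  ᵗpadB : ᵗ pad B ≈ pad A
  ᵗpadB i j = sym (ᵗpadA j i)

  colSumA : ∀ j → sum (λ i → A i j) ≡ k
  colSumA j = trans (sum-cong-≗ λ i → sym (transposed j i)) (rowSumB j)

  colSumB : ∀ j → sum (λ i → B i j) ≡ k
  colSumB j = trans (sum-cong-≗ λ i → transposed i j) (rowSumA j)

  -- This is n - 1, expressed through the valency by `order` so that it is polynomial in `k`.
  order′ : ℚ
  order′ = 1ℚ + k + k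

  -- `E²+AB+BA`, `EA+BE`, `A²+B²` and `EB+AE` evaluate the coefficients of t, ty, tx² and tx²y in a
  -- product of two μ's. Here the corner of E² is the number of points 1 + 2k, which agrees with the
  -- coefficient of I in the large block: 2k from `mixed` and 1 from J.
  E²+AB+BA : ∀ i j → (E m ∙ E m) i j + (pad A ∙ pad B) i j + (pad B ∙ pad A) i j ≡
    order′ * I (suc m) i j + k * (pad A i j + pad B i j)
  E²+AB+BA i j = trans (cong₂ _+_ (cong₂ _+_ (E∙E m i j) (pad∙pad A B i j)) (pad∙pad B A i j)) (cases i j)
    where
    offDiagonal : ∀ a k → 0ℚ ≡ a * 0ℚ + k * 0ℚ
    offDiagonal = solve 2 (λ a k → con 0ℚ := a :* con 0ℚ :+ k :* con 0ℚ) refl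
    corner : ∀ a k → a + 0ℚ + 0ℚ ≡ a * 1ℚ + k * 0ℚ
    corner = solve 2 (λ a k → a :+ con 0ℚ :+ con 0ℚ := a :* con 1ℚ :+ k :* con 0ℚ) refl
    regroup : ∀ k u f → u + ((k + k) * u + k * f) ≡ (1ℚ + k + k) * u + k * f
    regroup = solve 3 (λ k u f → u :+ ((k :+ k) :* u :+ k :* f) := (con 1ℚ :+ k :+ k) :* u :+ k :* f) refl
    cases : ∀ i j → bordered (sum {m} (λ _ → 1ℚ)) 0ℚ 0ℚ (J m) i j + pad (A ∙ B) i j + pad (B ∙ A) i j ≡
      order′ * I (suc m) i j + k * (pad A i j + pad B i j)
    cases zero    zero    = trans (cong (λ a → a + 0ℚ + 0ℚ) order) (corner order′ k)
    cases zero    (suc j) = offDiagonal order′ k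
    cases (suc i) zero    = offDiagonal order′ k
    cases (suc i) (suc j) = begin
      1ℚ + ab + ba
        ≡⟨ cong (λ c → c + ab + ba) (oneHot-sum (complementary i j)) ⟨
      u + (0ℚ + A i j + B i j) + ab + ba
        ≡⟨ rearrange u (A i j) (B i j) ab ba ⟩
      u + (ab + ba + (A i j + B i j))
        ≡⟨ cong (u +_) (mixed i j) ⟩
      u + ((k + k) * u + k * (A i j + B i j))
        ≡⟨ regroup k u (A i j + B i j) ⟩
      order′ * u + k * (A i j + B i j) ∎
      where
      u ab ba : ℚ
      u = I m i j
      ab = (A ∙ B) i j
      ba = (B ∙ A) i j
      rearrange : ∀ u a b ab ba → u + (0ℚ + a + b) + ab + ba ≡ u + (ab + ba + (a + b))
      rearrange = solve 5 (λ u a b ab ba → u :+ (con 0ℚ :+ a :+ b) :+ ab :+ ba := u :+ (ab :+ ba :+ (a :+ b))) refl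

  A²+B² : ∀ i j → (pad A ∙ pad A) i j + (pad B ∙ pad B) i j ≡ k * (pad A i j + pad B i j)
  A²+B² i j = trans (cong₂ _+_ (pad∙pad A A i j) (pad∙pad B B i j)) (cases i j)
    where
    cases : ∀ i j → pad (A ∙ A) i j + pad (B ∙ B) i j ≡ k * (pad A i j + pad B i j)
    cases zero    zero    = sym (ℚ.*-zeroʳ k)
    cases zero    (suc j) = sym (ℚ.*-zeroʳ k)
    cases (suc i) zero    = sym (ℚ.*-zeroʳ k)
    cases (suc i) (suc j) = squares i j

  -- A product with `E` on the left fills only the top border, one with `E` on the right only the
  -- left border. One of each makes a multiple of `E` because all row and column sums equal `k`.
  bordered-E : ∀ i j → bordered 0ℚ k 0ℚ (O m m) i j + bordered 0ℚ 0ℚ k (O m m) i j ≡ k * E m i j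
  bordered-E zero    zero    = sym (ℚ.*-zeroʳ k)
  bordered-E zero    (suc j) = trans (ℚ.+-identityʳ k) (sym (ℚ.*-identityʳ k))
  bordered-E (suc i) zero    = trans (ℚ.+-identityˡ k) (sym (ℚ.*-identityʳ k))
  bordered-E (suc i) (suc j) = sym (ℚ.*-zeroʳ k)

  EA+BE : ∀ i j → (E m ∙ pad A) i j + (pad B ∙ E m) i j ≡ k * E m i j
  EA+BE i j = trans (cong₂ _+_ (E∙pad A colSumA i j) (pad∙E B rowSumB i j)) (bordered-E i j)

  EB+AE : ∀ i j → (E m ∙ pad B) i j + (pad A ∙ E m) i j ≡ k * E m i j
  EB+AE i j = trans (cong₂ _+_ (E∙pad B colSumB i j) (pad∙E A rowSumA i j)) (bordered-E i j)

-- The scheme of order 4n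

zeroOne-* : ∀ {a b} → a ≡ 0ℚ ⊎ a ≡ 1ℚ → b ≡ 0ℚ ⊎ b ≡ 1ℚ → a * b ≡ 0ℚ ⊎ a * b ≡ 1ℚ
zeroOne-* {b = b} (inj₁ refl) _ = inj₁ (ℚ.*-zeroˡ b)
zeroOne-* {b = b} (inj₂ refl) zeroOne = subst (λ c → c ≡ 0ℚ ⊎ c ≡ 1ℚ) (sym (ℚ.*-identityˡ b)) zeroOne

select₀ : ∀ u v w → 0ℚ * u + 0ℚ * v + 0ℚ * w ≡ 0ℚ
select₀ = solve 3 (λ u v w → con 0ℚ :* u :+ con 0ℚ :* v :+ con 0ℚ :* w := con 0ℚ) refl

select₁ : ∀ u v w → 1ℚ * u + 0ℚ * v + 0ℚ * w ≡ u
select₁ = solve 3 (λ u v w → con 1ℚ :* u :+ con 0ℚ :* v :+ con 0ℚ :* w := u) refl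

select₂ : ∀ u v w → 0ℚ * u + 1ℚ * v + 0ℚ * w ≡ v
select₂ = solve 3 (λ u v w → con 0ℚ :* u :+ con 1ℚ :* v :+ con 0ℚ :* w := v) refl

select₃ : ∀ u v w → 0ℚ * u + 0ℚ * v + 1ℚ * w ≡ w
select₃ = solve 3 (λ u v w → con 0ℚ :* u :+ con 0ℚ :* v :+ con 1ℚ :* w := w) refl

zeroOne-select : ∀ {a b c d u v w} → OneHot a b c d →
  u ≡ 0ℚ ⊎ u ≡ 1ℚ → v ≡ 0ℚ ⊎ v ≡ 1ℚ → w ≡ 0ℚ ⊎ w ≡ 1ℚ →
  b * u + c * v + d * w ≡ 0ℚ ⊎ b * u + c * v + d * w ≡ 1ℚ
zeroOne-select {u = u} {v} {w} hot₀ _ _ _  = inj₁ (select₀ u v w)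
zeroOne-select {u = u} {v} {w} hot₁ zeroOne _ _ = subst (λ c → c ≡ 0ℚ ⊎ c ≡ 1ℚ) (sym (select₁ u v w)) zeroOne
zeroOne-select {u = u} {v} {w} hot₂ _ zeroOne _ = subst (λ c → c ≡ 0ℚ ⊎ c ≡ 1ℚ) (sym (select₂ u v w)) zeroOne
zeroOne-select {u = u} {v} {w} hot₃ _ _ zeroOne = subst (λ c → c ≡ 0ℚ ⊎ c ≡ 1ℚ) (sym (select₃ u v w)) zeroOne

∙-distrib₃ˡ : (X : Matrix l m) (X′ Y′ Z′ : Matrix m n) → X ∙ (X′ ⊕ Y′ ⊕ Z′) ≈ X ∙ X′ ⊕ X ∙ Y′ ⊕ X ∙ Z′
∙-distrib₃ˡ X X′ Y′ Z′ i j =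
  trans (∙-distribˡ-⊕ X (X′ ⊕ Y′) Z′ i j) (cong (_+ (X ∙ Z′) i j) (∙-distribˡ-⊕ X X′ Y′ i j))

∙-distrib₃ʳ : (X Y Z : Matrix l m) (X′ : Matrix m n) → (X ⊕ Y ⊕ Z) ∙ X′ ≈ X ∙ X′ ⊕ Y ∙ X′ ⊕ Z ∙ X′
∙-distrib₃ʳ X Y Z X′ i j =
  trans (∙-distribʳ-⊕ X′ (X ⊕ Y) Z i j) (cong (_+ (Z ∙ X′) i j) (∙-distribʳ-⊕ X′ X Y i j))

∙-expand : (X Y Z : Matrix l m) (X′ Y′ Z′ : Matrix m n) → (X ⊕ Y ⊕ Z) ∙ (X′ ⊕ Y′ ⊕ Z′) ≈
  (X ∙ X′ ⊕ X ∙ Y′ ⊕ X ∙ Z′) ⊕ (Y ∙ X′ ⊕ Y ∙ Y′ ⊕ Y ∙ Z′) ⊕ (Z ∙ X′ ⊕ Z ∙ Y′ ⊕ Z ∙ Z′)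
∙-expand X Y Z X′ Y′ Z′ = ≈-trans (∙-distrib₃ʳ X Y Z (X′ ⊕ Y′ ⊕ Z′))
  (⊕-cong (⊕-cong (∙-distrib₃ˡ X X′ Y′ Z′) (∙-distrib₃ˡ Y X′ Y′ Z′)) (∙-distrib₃ˡ Z X′ Y′ Z′))

module Construction {A B : Matrix m m} (AB : DoublyRegular A B) where
  open DoublyRegular AB using (k; nonempty)
  open Bordered AB

  block : (P Q R : Matrix 4 4) → Matrix (suc m ℕ.* 4) (suc m ℕ.* 4)
  block P Q R = E m ⊗ P ⊕ pad A ⊗ Q ⊕ pad B ⊗ R

  block-cong : ∀ {P P′ Q Q′ R R′} → P ≈ P′ → Q ≈ Q′ → R ≈ R′ → block P Q R ≈ block P′ Q′ R′
  block-cong P≈P′ Q≈Q′ R≈R′ i j =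
    cong₂ _+_ (cong₂ _+_ (⊗-congˡ (E m) P≈P′ i j) (⊗-congˡ (pad A) Q≈Q′ i j)) (⊗-congˡ (pad B) R≈R′ i j)

  σ̂ μ̂ : Fin 4 → Matrix (suc m ℕ.* 4) (suc m ℕ.* 4)
  σ̂ a = σ m (h a)
  μ̂ a = block (g a) (g (1F ⊻ a)) (g (3F ⊻ a))

  member : D₈ → Matrix (suc m ℕ.* 4) (suc m ℕ.* 4)
  member = [ σ̂ , μ̂ ]′

  S : Vector (Matrix (suc m ℕ.* 4) (suc m ℕ.* 4)) 8
  S i = member (splitAt 4 i)

  index : D₈ → Fin 8
  index = join 4 4

  S-index : ∀ e → S (index e) ≈ member e
  S-index e i j = cong (λ f → member f i j) (splitAt-join 4 4 e)

  μ≈μ̂ : ∀ {M} a → M ≈ g a → μ A B M ≈ μ̂ a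
  μ≈μ̂ a M≈g = block-cong M≈g
    (≈-trans (∙-cong M≈g y≈h) (g∙h a 1F))
    (≈-trans (∙-cong M≈g x²y≈h) (g∙h a 3F))

  σ≈σ̂ : ∀ {M} a → M ≈ h a → σ m M ≈ σ̂ a
  σ≈σ̂ a M≈h = ⊗-congˡ (I (suc m)) M≈h

  𝒟⇔S : ∀ M → M ∈ 𝒟 A B ⇔ (∃[ i ] M ≈ S i)
  𝒟⇔S M = mk⇔ to (λ (i , M≈S) → from (splitAt 4 i) M≈S)
    where
    to : M ∈ 𝒟 A B → ∃[ i ] M ≈ S i
    to (inj₁ (N , N∈H , M≈σ)) =
      let a , N≈h = H⇒≈h N∈H
      in index (inj₁ a) , ≈-trans M≈σ (≈-trans (σ≈σ̂ a N≈h) (≈-sym (S-index (inj₁ a))))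
    to (inj₂ (N , N∈G∖H , M≈μ)) =
      let a , N≈g = G∖H⇒≈g N∈G∖H
      in index (inj₂ a) , ≈-trans M≈μ (≈-trans (μ≈μ̂ a N≈g) (≈-sym (S-index (inj₂ a))))
    from : ∀ e → M ≈ member e → M ∈ 𝒟 A B
    from (inj₁ a) M≈σ̂ = inj₁ (h a , ≈h⇒H a (λ _ _ → refl) , M≈σ̂)
    from (inj₂ a) M≈μ̂ = inj₂ (g a , (g∈G a , ≈g⇒∉H a (λ _ _ → refl)) ,
      ≈-trans M≈μ̂ (≈-sym (μ≈μ̂ a (λ _ _ → refl))))

  σ-combine : ∀ C b c r s → σ m C (combine b r) (combine c s) ≡ I (suc m) b c * C r s
  σ-combine C b c r s = ⊗-combine (I (suc m)) C b r c s

  block-combine : ∀ P Q R b c r s → block P Q R (combine b r) (combine c s) ≡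
    E m b c * P r s + pad A b c * Q r s + pad B b c * R r s
  block-combine P Q R b c r s = cong₂ _+_
    (cong₂ _+_ (⊗-combine (E m) P b r c s) (⊗-combine (pad A) Q b r c s)) (⊗-combine (pad B) R b r c s)

  -- Each member has an entry 1 that no other member has: in the first row, in
  -- the diagonal block for σ and in an off-diagonal block for μ.
  mark : ∀ e → ∃₂ λ i j → member e i j ≡ 1ℚ × (∀ f → member f i j ≡ 1ℚ → f ≡ e)
  mark (inj₁ a) = combine {suc m} 0F 0F , combine {suc m} 0F a ,
    trans (atσ̂ a) (trans (cong (λ b → I 4 b a) (⊻-identityʳ a)) (I-diagonal a)) , unique
    where
    atσ̂ : ∀ b → σ̂ b (combine {suc m} 0F 0F) (combine {suc m} 0F a) ≡ I 4 (b ⊻ 0F) a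
    atσ̂ b = trans (σ-combine (h b) 0F 0F 0F a) (ℚ.*-identityˡ (I 4 (b ⊻ 0F) a))
    unique : ∀ f → member f (combine {suc m} 0F 0F) (combine {suc m} 0F a) ≡ 1ℚ → f ≡ inj₁ a
    unique (inj₁ b) eq = cong inj₁ (trans (sym (⊻-identityʳ b)) (I≡1⇒≡ (trans (sym (atσ̂ b)) eq)))
    unique (inj₂ b) eq = contradiction
      (trans (sym eq) (trans (block-combine (g b) (g (1F ⊻ b)) (g (3F ⊻ b)) 0F 0F 0F a) (select₀ (g b 0F a) (g (1F ⊻ b) 0F a) (g (3F ⊻ b) 0F a))))
      ℚ.1≢0
  -- `g a` sends 0F to `a ⊻ rotate 0F`, which is `a ⊻ 1F`. Any block column other than 0F will do,
  -- as `E m` is 1 there in its first row; `nonempty` supplies one.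
  mark (inj₂ a) = combine {suc m} 0F 0F , combine v (a ⊻ 1F) , trans (atμ̂ a) (I-diagonal (a ⊻ 1F)) , unique
    where
    v : Fin (suc m)
    v = suc (proj₁ nonempty)
    atμ̂ : ∀ b → μ̂ b (combine {suc m} 0F 0F) (combine v (a ⊻ 1F)) ≡ I 4 (b ⊻ 1F) (a ⊻ 1F)
    atμ̂ b = trans (block-combine (g b) (g (1F ⊻ b)) (g (3F ⊻ b)) 0F v 0F (a ⊻ 1F))
      (select₁ (g b 0F (a ⊻ 1F)) (g (1F ⊻ b) 0F (a ⊻ 1F)) (g (3F ⊻ b) 0F (a ⊻ 1F)))
    unique : ∀ f → member f (combine {suc m} 0F 0F) (combine v (a ⊻ 1F)) ≡ 1ℚ → f ≡ inj₂ a
    unique (inj₁ b) eq = contradiction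
      (trans (sym eq) (trans (σ-combine (h b) 0F v 0F (a ⊻ 1F)) (ℚ.*-zeroˡ (h b 0F (a ⊻ 1F)))))
      ℚ.1≢0
    unique (inj₂ b) eq = cong inj₂ (⊻-cancelʳ b a 1F (I≡1⇒≡ (trans (sym (atμ̂ b)) eq)))

  distinct : ∀ {i j} → S i ≈ S j → i ≡ j
  distinct {i} {j} Si≈Sj with mark (splitAt 4 j)
  ... | p , q , eq , unique = begin
    i                     ≡⟨ join-splitAt 4 4 i ⟨
    index (splitAt 4 i)   ≡⟨ cong index (unique (splitAt 4 i) (trans (Si≈Sj p q) eq)) ⟩
    index (splitAt 4 j)   ≡⟨ join-splitAt 4 4 j ⟩
    j                     ∎

  nonZero : ∀ i → ¬ S i ≈ O _ _
  nonZero i Si≈O with mark (splitAt 4 i)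
  ... | p , q , eq , _ = contradiction (trans (sym eq) (Si≈O p q)) ℚ.1≢0

  member-zeroOne : ∀ e i j → member e i j ≡ 0ℚ ⊎ member e i j ≡ 1ℚ
  member-zeroOne (inj₁ a) i j = zeroOne-* (I-zeroOne (quotient {suc m} 4 i) _) (I-zeroOne (a ⊻ remainder {suc m} 4 i) _)
  member-zeroOne (inj₂ a) i j = zeroOne-select (hot (quotient 4 i) (quotient 4 j))
    (I-zeroOne (a ⊻ i₂) j₂) (I-zeroOne (1F ⊻ a ⊻ i₂) j₂) (I-zeroOne (3F ⊻ a ⊻ i₂) j₂)
    where
    i₂ = rotate (remainder {suc m} 4 i)
    j₂ = remainder {suc m} 4 j

  sum≈J : ∀ i j → sum (λ e → S e i j) ≡ 1ℚ
  sum≈J i j = begin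
    sum (λ e → S e i j)
      ≡⟨ sum-++ 4 (λ e → S e i j) ⟩
    sum {4} (λ a → S (a ↑ˡ 4) i j) + sum {4} (λ a → S (4 ↑ʳ a) i j)
      ≡⟨ cong₂ _+_ (sum-cong-≗ λ a → S-index (inj₁ a) i j) (sum-cong-≗ λ a → S-index (inj₂ a) i j) ⟩
    sum (λ a → σ̂ a i j) + sum (λ a → μ̂ a i j)
      ≡⟨ cong₂ _+_ (scaled u (λ a → h a i₂ j₂) (sum-h i₂ j₂)) sum-μ̂ ⟩
    u + (e + b + c)
      ≡⟨ oneHot-sum (hot i₁ j₁) ⟩
    1ℚ ∎
    where
    i₁ = quotient {suc m} 4 i
    j₁ = quotient {suc m} 4 j
    i₂ = remainder {suc m} 4 i
    j₂ = remainder {suc m} 4 j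
    u = I (suc m) i₁ j₁
    e = E m i₁ j₁
    b = pad A i₁ j₁
    c = pad B i₁ j₁
    scaled : ∀ t (f : Fin 4 → ℚ) → sum f ≡ 1ℚ → sum (λ a → t * f a) ≡ t
    scaled t f sum≡1 = trans (sym (*-distribˡ-sum t f)) (trans (cong (t *_) sum≡1) (ℚ.*-identityʳ t))
    sum-μ̂ : sum (λ a → μ̂ a i j) ≡ e + b + c
    sum-μ̂ = begin
      sum (λ a → e * g a i₂ j₂ + b * g (1F ⊻ a) i₂ j₂ + c * g (3F ⊻ a) i₂ j₂)
        ≡⟨ ∑-distrib-+ (λ a → e * g a i₂ j₂ + b * g (1F ⊻ a) i₂ j₂) (λ a → c * g (3F ⊻ a) i₂ j₂) ⟩
      sum (λ a → e * g a i₂ j₂ + b * g (1F ⊻ a) i₂ j₂) + sum (λ a → c * g (3F ⊻ a) i₂ j₂)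
        ≡⟨ cong₂ _+_ (∑-distrib-+ (λ a → e * g a i₂ j₂) (λ a → b * g (1F ⊻ a) i₂ j₂)) (scaled c (λ a → g (3F ⊻ a) i₂ j₂) (sum-g 3F i₂ j₂)) ⟩
      sum (λ a → e * g a i₂ j₂) + sum (λ a → b * g (1F ⊻ a) i₂ j₂) + c
        ≡⟨ cong₂ (λ s t → s + t + c) (scaled e (λ a → g a i₂ j₂) (sum-g 0F i₂ j₂)) (scaled b (λ a → g (1F ⊻ a) i₂ j₂) (sum-g 1F i₂ j₂)) ⟩
      e + b + c ∎

  -- Two exchanges cancel: transposing swaps the blocks `pad A` and `pad B`, and inverting in the
  -- coset applies `φ`, which swaps the twists 1F and 3F.
  ᵗμ̂ : ∀ a → ᵗ μ̂ a ≈ μ̂ (φ a ⊻ 2F)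
  ᵗμ̂ a i j = begin
    E m j₁ i₁ * g a j₂ i₂ + pad A j₁ i₁ * g (1F ⊻ a) j₂ i₂ + pad B j₁ i₁ * g (3F ⊻ a) j₂ i₂
      ≡⟨ cong₂ _+_ (cong₂ _+_ (cong₂ _*_ (E-symmetric j₁ i₁) (ᵗg a i₂ j₂))
           (cong₂ _*_ (ᵗpadA i₁ j₁) (conj 1F)))
           (cong₂ _*_ (ᵗpadB i₁ j₁) (conj 3F)) ⟩
    E m i₁ j₁ * g a′ i₂ j₂ + pad B i₁ j₁ * g (3F ⊻ a′) i₂ j₂ + pad A i₁ j₁ * g (1F ⊻ a′) i₂ j₂
      ≡⟨ swap (E m i₁ j₁ * g a′ i₂ j₂) (pad B i₁ j₁ * g (3F ⊻ a′) i₂ j₂) (pad A i₁ j₁ * g (1F ⊻ a′) i₂ j₂) ⟩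
    E m i₁ j₁ * g a′ i₂ j₂ + pad A i₁ j₁ * g (1F ⊻ a′) i₂ j₂ + pad B i₁ j₁ * g (3F ⊻ a′) i₂ j₂ ∎
    where
    a′ = φ a ⊻ 2F
    i₁ = quotient {suc m} 4 i
    j₁ = quotient {suc m} 4 j
    i₂ = remainder {suc m} 4 i
    j₂ = remainder {suc m} 4 j
    φ-⊻ : ∀ c a → φ (c ⊻ a) ⊻ 2F ≡ φ c ⊻ (φ a ⊻ 2F)
    φ-⊻ = from-yes (all? λ c → all? λ a → φ (c ⊻ a) ⊻ 2F ≟ φ c ⊻ (φ a ⊻ 2F))
    conj : ∀ c → g (c ⊻ a) j₂ i₂ ≡ g (φ c ⊻ a′) i₂ j₂
    conj c = trans (ᵗg (c ⊻ a) i₂ j₂) (cong (λ d → g d i₂ j₂) (φ-⊻ c a))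
    swap : ∀ u v w → u + v + w ≡ u + w + v
    swap = solve 3 (λ u v w → u :+ v :+ w := u :+ w :+ v) refl

  σ∙block : ∀ C P Q R → σ m C ∙ block P Q R ≈ block (C ∙ P) (C ∙ Q) (C ∙ R)
  σ∙block C P Q R = ≈-trans (∙-distrib₃ˡ (σ m C) (E m ⊗ P) (pad A ⊗ Q) (pad B ⊗ R))
    λ i j → cong₂ _+_ (cong₂ _+_ (part (E m) P i j) (part (pad A) Q i j)) (part (pad B) R i j)
    where
    part : (X : Matrix (suc m) (suc m)) (P : Matrix 4 4) → σ m C ∙ (X ⊗ P) ≈ X ⊗ (C ∙ P)
    part X P = ≈-trans (⊗-∙-⊗ (I (suc m)) C X P) (⊗-congʳ (C ∙ P) (I∙ X))

  block∙σ : ∀ C P Q R → block P Q R ∙ σ m C ≈ block (P ∙ C) (Q ∙ C) (R ∙ C)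
  block∙σ C P Q R = ≈-trans (∙-distrib₃ʳ (E m ⊗ P) (pad A ⊗ Q) (pad B ⊗ R) (σ m C))
    λ i j → cong₂ _+_ (cong₂ _+_ (part (E m) P i j) (part (pad A) Q i j)) (part (pad B) R i j)
    where
    part : (X : Matrix (suc m) (suc m)) (P : Matrix 4 4) → (X ⊗ P) ∙ σ m C ≈ X ⊗ (P ∙ C)
    part X P = ≈-trans (⊗-∙-⊗ X P (I (suc m)) C) (⊗-congʳ (P ∙ C) (∙I X))

  σ̂∙σ̂ : ∀ a b → σ̂ a ∙ σ̂ b ≈ σ̂ (b ⊻ a)
  σ̂∙σ̂ a b = ≈-trans (⊗-∙-⊗ (I (suc m)) (h a) (I (suc m)) (h b)) 
    (≈-trans (⊗-congʳ (h a ∙ h b) (I∙ (I (suc m)))) (⊗-congˡ (I (suc m)) (h∙h a b)))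

  g-cong : ∀ {a b} → a ≡ b → g a ≈ g b
  g-cong a≡b i j = cong (λ c → g c i j) a≡b

  σ̂∙μ̂ : ∀ a b → σ̂ a ∙ μ̂ b ≈ μ̂ (b ⊻ φ a)
  σ̂∙μ̂ a b = ≈-trans (σ∙block (h a) (g b) (g (1F ⊻ b)) (g (3F ⊻ b)))
    (block-cong (h∙g a b) (shifted 1F) (shifted 3F))
    where
    shifted : ∀ c → h a ∙ g (c ⊻ b) ≈ g (c ⊻ (b ⊻ φ a))
    shifted c = ≈-trans (h∙g a (c ⊻ b)) (g-cong (sym (⊻-assoc c b (φ a))))

  -- H is abelian, so `h b` passes the twists y and x²y and acts on all three blocks alike.
  μ̂∙σ̂ : ∀ a b → μ̂ a ∙ σ̂ b ≈ μ̂ (b ⊻ a)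
  μ̂∙σ̂ a b = ≈-trans (block∙σ (h b) (g a) (g (1F ⊻ a)) (g (3F ⊻ a)))
    (block-cong (g∙h a b) (shifted 1F) (shifted 3F))
    where
    shifted : ∀ c → g (c ⊻ a) ∙ h b ≈ g (c ⊻ (b ⊻ a))
    shifted c = ≈-trans (g∙h (c ⊻ a) b) (g-cong (begin
      b ⊻ (c ⊻ a) ≡⟨ ⊻-assoc b c a ⟩
      b ⊻ c ⊻ a   ≡⟨ cong (_⊻ a) (⊻-comm b c) ⟩
      c ⊻ b ⊻ a   ≡⟨ ⊻-assoc c b a ⟨
      c ⊻ (b ⊻ a) ∎))

  μ̂∙μ̂ : ∀ a b → let t = b ⊻ φ a ⊻ 2F in
    μ̂ a ∙ μ̂ b ≈ order′ • σ̂ t ⊕ (k • μ̂ t ⊕ k • μ̂ (t ⊻ 2F))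
  μ̂∙μ̂ a b i j = begin
    (μ̂ a ∙ μ̂ b) i j
      ≡⟨ ∙-expand (E m ⊗ g a) (pad A ⊗ g (1F ⊻ a)) (pad B ⊗ g (3F ⊻ a)) (E m ⊗ g b) (pad A ⊗ g (1F ⊻ b)) (pad B ⊗ g (3F ⊻ b)) i j ⟩
    _ ≡⟨ cong₂ _+_ (cong₂ _+_
           (cong₂ _+_ (cong₂ _+_ (cell (E m) (E m) 0F 0F) (cell (E m) (pad A) 0F 1F)) (cell (E m) (pad B) 0F 3F))
           (cong₂ _+_ (cong₂ _+_ (cell (pad A) (E m) 1F 0F) (cell (pad A) (pad A) 1F 1F)) (cell (pad A) (pad B) 1F 3F)))
           (cong₂ _+_ (cong₂ _+_ (cell (pad B) (E m) 3F 0F) (cell (pad B) (pad A) 3F 1F)) (cell (pad B) (pad B) 3F 3F)) ⟩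
    -- Twists `c` and `d` contribute `d ⊻ φ c`. As `φ` exchanges 1F and 3F, mixed products of the
    -- pads land on `h₀` and their squares on `h₂`.
    ee * h₀ + ea * h₁ + eb * h₃ + (ae * h₃ + aa * h₂ + ab * h₀) + (be * h₁ + ba * h₀ + bb * h₂)
      ≡⟨ collect ee ea eb ae aa ab be ba bb h₀ h₁ h₂ h₃ ⟩
    (ee + ab + ba) * h₀ + (ea + be) * h₁ + (aa + bb) * h₂ + (eb + ae) * h₃
      ≡⟨ cong₂ _+_ (cong₂ _+_ (cong₂ _+_ (cong (_* h₀) (E²+AB+BA i₁ j₁)) (cong (_* h₁) (EA+BE i₁ j₁)))
           (cong (_* h₂) (A²+B² i₁ j₁))) (cong (_* h₃) (EB+AE i₁ j₁)) ⟩
    (order′ * u + k * (pa + pb)) * h₀ + k * e * h₁ + k * (pa + pb) * h₂ + k * e * h₃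
      ≡⟨ regroup order′ k u e pa pb h₀ h₁ h₂ h₃ ⟩
    -- The order `h₂ + h₀` in the last bracket is the one `g⊕g≈h⊕h` produces at 3F, where `3F ⊻ 1F`
    -- computes to 2F and `3F ⊻ 3F` to 0F.
    order′ * (u * h₀) + k * (e * (h₁ + h₃) + pa * (h₀ + h₂) + pb * (h₂ + h₀))
      ≡⟨ cong (λ s → order′ * (u * h₀) + k * s) (cong₂ _+_ (cong₂ _+_
           (cong (e *_) (g⊕g≈h⊕h t 0F i₂ j₂)) (cong (pa *_) (g⊕g≈h⊕h t 1F i₂ j₂))) (cong (pb *_) (g⊕g≈h⊕h t 3F i₂ j₂))) ⟨
    order′ * (u * h₀) + k * (e * (g₀ + g₀′) + pa * (g₁ + g₁′) + pb * (g₃ + g₃′))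
      ≡⟨ distribute (order′ * (u * h₀)) k e pa pb g₀ g₀′ g₁ g₁′ g₃ g₃′ ⟩
    order′ * (u * h₀) + (k * (e * g₀ + pa * g₁ + pb * g₃) + k * (e * g₀′ + pa * g₁′ + pb * g₃′)) ∎
    where
    t = b ⊻ φ a ⊻ 2F
    i₁ = quotient {suc m} 4 i
    j₁ = quotient {suc m} 4 j
    i₂ = remainder {suc m} 4 i
    j₂ = remainder {suc m} 4 j
    u = I (suc m) i₁ j₁
    e = E m i₁ j₁
    pa = pad A i₁ j₁
    pb = pad B i₁ j₁
    ee = (E m ∙ E m) i₁ j₁
    ea = (E m ∙ pad A) i₁ j₁
    eb = (E m ∙ pad B) i₁ j₁
    ae = (pad A ∙ E m) i₁ j₁
    aa = (pad A ∙ pad A) i₁ j₁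
    ab = (pad A ∙ pad B) i₁ j₁
    be = (pad B ∙ E m) i₁ j₁
    ba = (pad B ∙ pad A) i₁ j₁
    bb = (pad B ∙ pad B) i₁ j₁
    h₀ = h t i₂ j₂
    h₁ = h (1F ⊻ t) i₂ j₂
    h₂ = h (2F ⊻ t) i₂ j₂
    h₃ = h (3F ⊻ t) i₂ j₂
    g₀ = g t i₂ j₂
    g₁ = g (1F ⊻ t) i₂ j₂
    g₃ = g (3F ⊻ t) i₂ j₂
    g₀′ = g (t ⊻ 2F) i₂ j₂
    g₁′ = g (1F ⊻ (t ⊻ 2F)) i₂ j₂
    g₃′ = g (3F ⊻ (t ⊻ 2F)) i₂ j₂

    shift : ∀ a b c d → d ⊻ b ⊻ φ (c ⊻ a) ⊻ 2F ≡ d ⊻ φ c ⊻ (b ⊻ φ a ⊻ 2F)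
    shift = from-yes (all? λ a → all? λ b → all? λ c → all? λ d →
      d ⊻ b ⊻ φ (c ⊻ a) ⊻ 2F ≟ d ⊻ φ c ⊻ (b ⊻ φ a ⊻ 2F))

    cell : (X Y : Matrix (suc m) (suc m)) (c d : Fin 4) → ((X ⊗ g (c ⊻ a)) ∙ (Y ⊗ g (d ⊻ b))) i j ≡ (X ∙ Y) i₁ j₁ * h (d ⊻ φ c ⊻ t) i₂ j₂
    cell X Y c d = trans (⊗-∙-⊗ X (g (c ⊻ a)) Y (g (d ⊻ b)) i j) (cong ((X ∙ Y) i₁ j₁ *_)
      (trans (g∙g (c ⊻ a) (d ⊻ b) i₂ j₂) (cong (λ f → h f i₂ j₂) (shift a b c d))))

    collect : ∀ ee ea eb ae aa ab be ba bb h₀ h₁ h₂ h₃ →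
      ee * h₀ + ea * h₁ + eb * h₃ + (ae * h₃ + aa * h₂ + ab * h₀) + (be * h₁ + ba * h₀ + bb * h₂) ≡
      (ee + ab + ba) * h₀ + (ea + be) * h₁ + (aa + bb) * h₂ + (eb + ae) * h₃
    collect = solve 13 (λ ee ea eb ae aa ab be ba bb h₀ h₁ h₂ h₃ →
      ee :* h₀ :+ ea :* h₁ :+ eb :* h₃ :+ (ae :* h₃ :+ aa :* h₂ :+ ab :* h₀) :+ (be :* h₁ :+ ba :* h₀ :+ bb :* h₂) :=
      (ee :+ ab :+ ba) :* h₀ :+ (ea :+ be) :* h₁ :+ (aa :+ bb) :* h₂ :+ (eb :+ ae) :* h₃) refl

    regroup : ∀ n k u e pa pb h₀ h₁ h₂ h₃ →
      (n * u + k * (pa + pb)) * h₀ + k * e * h₁ + k * (pa + pb) * h₂ + k * e * h₃ ≡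
      n * (u * h₀) + k * (e * (h₁ + h₃) + pa * (h₀ + h₂) + pb * (h₂ + h₀))
    regroup = solve 10 (λ n k u e pa pb h₀ h₁ h₂ h₃ →
      (n :* u :+ k :* (pa :+ pb)) :* h₀ :+ k :* e :* h₁ :+ k :* (pa :+ pb) :* h₂ :+ k :* e :* h₃ :=
      n :* (u :* h₀) :+ k :* (e :* (h₁ :+ h₃) :+ pa :* (h₀ :+ h₂) :+ pb :* (h₂ :+ h₀))) refl

    distribute : ∀ c k e pa pb g₀ g₀′ g₁ g₁′ g₃ g₃′ →
      c + k * (e * (g₀ + g₀′) + pa * (g₁ + g₁′) + pb * (g₃ + g₃′)) ≡
      c + (k * (e * g₀ + pa * g₁ + pb * g₃) + k * (e * g₀′ + pa * g₁′ + pb * g₃′))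
    distribute = solve 11 (λ c k e pa pb g₀ g₀′ g₁ g₁′ g₃ g₃′ →
      c :+ k :* (e :* (g₀ :+ g₀′) :+ pa :* (g₁ :+ g₁′) :+ pb :* (g₃ :+ g₃′)) :=
      c :+ (k :* (e :* g₀ :+ pa :* g₁ :+ pb :* g₃) :+ k :* (e :* g₀′ :+ pa :* g₁′ :+ pb :* g₃′))) refl

  isLC-≈member : ∀ {M} e → M ≈ member e → IsLinearCombinationOf M S
  isLC-≈member e M≈ = isLC-resp-≈ S (≈-trans M≈ (≈-sym (S-index e))) (isLC-member S (index e))

  transpose : ∀ e → IsLinearCombinationOf (ᵗ member e) S
  transpose (inj₁ a) = isLC-≈member (inj₁ a) λ i j → cong₂ _*_
    (I-sym (quotient {suc m} 4 j) (quotient 4 i)) (h-symmetric a (remainder {suc m} 4 i) (remainder {suc m} 4 j))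
  transpose (inj₂ a) = isLC-≈member (inj₂ (φ a ⊻ 2F)) (ᵗμ̂ a)

  product : ∀ e f → IsLinearCombinationOf (member e ∙ member f) S
  product (inj₁ a) (inj₁ b) = isLC-≈member (inj₁ (b ⊻ a)) (σ̂∙σ̂ a b)
  product (inj₁ a) (inj₂ b) = isLC-≈member (inj₂ (b ⊻ φ a)) (σ̂∙μ̂ a b)
  product (inj₂ a) (inj₁ b) = isLC-≈member (inj₂ (b ⊻ a)) (μ̂∙σ̂ a b)
  product (inj₂ a) (inj₂ b) = isLC-resp-≈ S (μ̂∙μ̂ a b)
    (isLC-⊕ S (isLC-• S order′ (single (inj₁ t))) (isLC-⊕ S (isLC-• S k (single (inj₂ t))) (isLC-• S k (single (inj₂ (t ⊻ 2F))))))
    where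
    t = b ⊻ φ a ⊻ 2F
    single : ∀ e → IsLinearCombinationOf (member e) S
    single e = isLC-≈member e (λ _ _ → refl)

  formsAssociationScheme : FormsAssociationScheme (𝒟 A B)
  formsAssociationScheme = 7 , S , 𝒟⇔S , record
    { distinct  = distinct
    ; nonZero   = nonZero
    ; zeroOne   = λ e → member-zeroOne (splitAt 4 e)
    ; identity  = ≈-trans (≈-sym (σ≈σ̂ 0F 1≈h)) (I⊗I (suc m) 4)
    ; sum≈J     = sum≈J
    ; transpose = λ e → transpose (splitAt 4 e)
    ; product   = λ e f → product (splitAt 4 e) (splitAt 4 f)
    }

-- From the scheme axioms to a doubly regular tournament

-- Finite index sets and decidable equality on ℚ turn the negated universal statement into a
-- witness.
nonzeroEntry : (A : Matrix m n) → ¬ A ≈ O m n → ∃₂ λ i j → A i j ≢ 0ℚ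
nonzeroEntry {m} {n} A A≉O =
  let i , Ai≉0 = ¬∀⟶∃¬ m (λ i → ∀ j → A i j ≡ 0ℚ) (λ i → all? λ j → A i j ℚ.≟ 0ℚ) A≉O
      j , Aij≢0 = ¬∀⟶∃¬ n (λ j → A i j ≡ 0ℚ) (λ j → A i j ℚ.≟ 0ℚ) Ai≉0
  in i , j , Aij≢0

theorem3p6 : (m : ℕ) (A₀ A₁ A₂ : Matrix m m) →
    IsAssociationScheme (A₀ ∷ A₁ ∷ A₂ ∷ []) →
    NonSymmetric (A₀ ∷ A₁ ∷ A₂ ∷ []) →
    A₀ ≈ I m →
    A₂ ≈ ᵗ A₁ →
    FormsAssociationScheme (𝒟 A₁ A₂)
theorem3p6 m A₀ A₁ A₂ scheme _ A₀≈I A₂≈ᵗA₁ =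
  Construction.formsAssociationScheme (doublyRegular A₁A₂ A₂A₁)
  where
  open IsAssociationScheme scheme

  complementary : ∀ i j → OneHot (I m i j) 0ℚ (A₁ i j) (A₂ i j)
  complementary i j = subst (λ u → OneHot u 0ℚ (A₁ i j) (A₂ i j)) (A₀≈I i j)
    (zeroOne⇒oneHot (zeroOne 0F i j) (zeroOne 1F i j) (zeroOne 2F i j) (sum≈J i j))

  nonempty : ∃₂ λ i j → A₁ i j ≡ 1ℚ
  nonempty =
    let i , j , A₁ij≢0 = nonzeroEntry A₁ (nonZero 1F)
    in i , j , [ (λ A₁ij≡0 → contradiction A₁ij≡0 A₁ij≢0) , id ]′ (zeroOne 1F i j)

  coefficients : ∀ {M} → IsLinearCombinationOf M (A₀ ∷ A₁ ∷ A₂ ∷ []) →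
    ∃[ c₀ ] ∃[ c₁ ] ∃[ c₂ ] M ≈ c₀ • I m ⊕ c₁ • A₁ ⊕ c₂ • A₂
  coefficients {M} (c , M≈) = c 0F , c 1F , c 2F , λ i j → begin
    M i j
      ≡⟨ M≈ i j ⟩
    c 0F * A₀ i j + (c 1F * A₁ i j + (c 2F * A₂ i j + 0ℚ))
      ≡⟨ cong (λ u → c 0F * u + (c 1F * A₁ i j + (c 2F * A₂ i j + 0ℚ))) (A₀≈I i j) ⟩
    c 0F * I m i j + (c 1F * A₁ i j + (c 2F * A₂ i j + 0ℚ))
      ≡⟨ reassociate (c 0F * I m i j) (c 1F * A₁ i j) (c 2F * A₂ i j) ⟩
    c 0F * I m i j + c 1F * A₁ i j + c 2F * A₂ i j ∎
    where
    reassociate : ∀ u v w → u + (v + (w + 0ℚ)) ≡ u + v + w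
    reassociate = solve 3 (λ u v w → u :+ (v :+ (w :+ con 0ℚ)) := u :+ v :+ w) refl

  A₁A₂ : TransposePair A₁ A₂
  A₁A₂ = record
    { complementary = complementary
    ; transposed    = A₂≈ᵗA₁
    ; product       = coefficients (product 1F 2F)
    ; nonempty      = nonempty
    }

  A₂A₁ : TransposePair A₂ A₁
  A₂A₁ = record
    { complementary = λ i j → oneHot-swap (complementary i j)
    ; transposed    = λ i j → sym (A₂≈ᵗA₁ j i)
    ; product       =
        let c₀ , c₁ , c₂ , eq = coefficients (product 2F 1F)
        in c₀ , c₂ , c₁ , λ i j → trans (eq i j) (swap (c₀ * I m i j) (c₁ * A₁ i j) (c₂ * A₂ i j))
    ; nonempty      = let i , j , A₁ij≡1 = nonempty in j , i , trans (A₂≈ᵗA₁ j i) A₁ij≡1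
    }
    where
    swap : ∀ u v w → u + v + w ≡ u + w + v
    swap = solve 3 (λ u v w → u :+ v :+ w := u :+ w :+ v) refl
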